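{- For any constant $c$ with $5/3\leq c\leq 2$ and any $m\ge2$, the algorithm ALG($c$) described in the context is $c$-competitive: for every job sequence $\sigma$, the makespan of its final schedule is at most $c\cdot\mathrm{OPT}(\sigma)$.
   Context: Problem: jobs $J_1,\dots,J_n$ with processing times $p_i>0$ arrive online and must be assigned non-preemptively and immediately to one of $m$ identical machines $M_1,\dots,M_m$; a migration removes an assigned job and reassigns it. Makespan = maximum machine load in the final schedule; $\mathrm{OPT}(\sigma)$ = optimum offline makespan. Notation: $p_t^+=\sum_{i\le t}p_i$; $p_t^i$ = $i$-th largest processing time among $J_1,\dots,J_t$ ($0$ if $i>t$). $L_t=\max\{p_t^+/m,\ p_t^1,\ 2p_t^{m+1}\}$. Job $J_i$, $i\le t$, is small at time $t$ if $p_i\le(2c-3)L_t$; $J_t$ is small if small at time $t$, large otherwise. $\ell(j,t)$ = load of $M_j$ just before $J_t$ is assigned; $\ell_s(j,t)$ = same load counting only jobs small at time $t$. Machine sets: $A=\{M_1,\dots,M_{\lfloor m/2\rfloor}\}$, $B=\{M_{\lfloor m/2\rfloor+1},\dots,M_m\}$. Algorithm ALG($c$). Arrival phase: if $J_t$ is small, let $A'=\{M_j\in A:\ell_s(j,t)\le(c-1)L_t\}$; if $A'\ne\emptyset$ assign $J_t$ to a machine of $A'$ with smallest $\ell_s(j,t)$, otherwise to a least loaded machine of $B$. If $J_t$ is large: if some $M_j\in A$ has $\ell(j,t)\le(3-c)L_t$, assign $J_t$ to a least loaded machine of $A$, otherwise to a least loaded machine of $B$. Let $L=L_n$. Migration phase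 (after all jobs arrived; $\ell(j)$ = current load): removal: $R=\emptyset$; from every machine of $B$ remove its largest job and add it to $R$; while some $M_j\in A$ has $\ell(j)>(c-1)L$, remove its largest job and add it to $R$. Reassignment: sort $R$ by non-increasing processing time; for each job $J$ in this order, if some $M_j\in B$ has $\ell(j)+p(J)\le cL$ assign $J$ to such a machine, otherwise assign $J$ to a least loaded machine of $A$.
   Formalization: The processing times of the jobs and the constant c (with 5/3 ≤ c ≤ 2) are taken to be rational numbers instead of real numbers. -}

module Defs where

open import Data.Nat as ℕ using (ℕ; zero; suc; NonZero; ⌊_/2⌋)
open import Data.Fin as Fin using (Fin; toℕ)
open import Data.Integer using (+_)
open import Data.Rational using (ℚ; 0ℚ; 1ℚ; _+_; _*_; _-_; _≤_; _<_; _⊔_; _⊓_; _/_)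
open import Data.Rational.Properties using (_≤?_; ≤-decTotalOrder)
open import Data.List using (List; []; _∷_; _++_; map; foldr; reverse; filter; allFin; concatMap)
open import Data.List.Relation.Unary.All using (All)
open import Data.List.Relation.Unary.Linked using (Linked)
open import Data.List.Relation.Binary.Permutation.Propositional using (_↭_)
open import Data.Product using (Σ; ∃; _×_; _,_; proj₁; proj₂)
open import Relation.Nullary using (¬_; does)
open import Relation.Binary.PropositionalEquality using (_≡_; _≢_)
open import Data.Bool using (if_then_else_)
import Data.List.Sort

sumℚ : List ℚ → ℚ
sumℚ = foldr _+_ 0ℚ

-- maximum of a list of (nonnegative) rationals; 0 for the empty list
maxℚ : List ℚ → ℚ
maxℚ = foldr _⊔_ 0ℚ

-- minimum of a list of rationals (0 for the empty list; only used on nonempty lists)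
minℚ : List ℚ → ℚ
minℚ [] = 0ℚ
minℚ (x ∷ xs) = foldr _⊓_ x xs

-- i-th element (0-based) of a list, 0 if out of range
nth : ℕ → List ℚ → ℚ
nth _ [] = 0ℚ
nth zero (x ∷ xs) = x
nth (suc i) (x ∷ xs) = nth i xs

open Data.List.Sort ≤-decTotalOrder using (sort)

sortDesc : List ℚ → List ℚ
sortDesc xs = reverse (sort xs)

-- (i+1)-th largest element of a list (0-based i), 0 if i ≥ length
largest : ℕ → List ℚ → ℚ
largest i xs = nth i (sortDesc xs)

two : ℚ
two = + 2 / 1

module Alg (m : ℕ) {{nz : NonZero m}} (c : ℚ) where

  Sched : Set
  Sched = List (ℚ × Fin m)

  load : Sched → Fin m → ℚ
  load [] j = 0ℚ
  load ((p , j') ∷ S) j = if does (j' Fin.≟ j) then p + load S j else load S j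

  makespan : Sched → ℚ
  makespan S = maxℚ (map (load S) (allFin m))

  assignments : ℕ → List (List (Fin m))
  assignments zero = [] ∷ []
  assignments (suc n) = concatMap (λ a → map (λ j → j ∷ a) (allFin m)) (assignments n)

  zipS : List ℚ → List (Fin m) → Sched
  zipS [] _ = []
  zipS (_ ∷ _) [] = []
  zipS (p ∷ ps) (j ∷ js) = (p , j) ∷ zipS ps js

  len : List ℚ → ℕ
  len [] = zero
  len (_ ∷ xs) = suc (len xs)

  OPT : List ℚ → ℚ
  OPT σ = minℚ (map (λ a → makespan (zipS σ a)) (assignments (len σ)))

  Lof : List ℚ → ℚ
  Lof ps = ((sumℚ ps * (+ 1 / m)) ⊔ largest 0 ps) ⊔ (two * largest m ps)

  -- machine sets A = {M_1..M_⌊m/2⌋}, B = the rest (0-based indices)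
  InA : Fin m → Set
  InA j = toℕ j ℕ.< ⌊ m /2⌋

  InB : Fin m → Set
  InB j = ⌊ m /2⌋ ℕ.≤ toℕ j

  Bmachines : List (Fin m)
  Bmachines = filter (λ j → ⌊ m /2⌋ ℕ.≤? toℕ j) (allFin m)

  Small : ℚ → ℚ → Set
  Small L q = q ≤ ((two * c) - (+ 3 / 1)) * L

  loadSmall : ℚ → Sched → Fin m → ℚ
  loadSmall L [] j = 0ℚ
  loadSmall L ((p , j') ∷ S) j =
    if does (j' Fin.≟ j) then (if does (p ≤? (((two * c) - (+ 3 / 1)) * L)) then p + loadSmall L S j else loadSmall L S j)
    else loadSmall L S j

  data ArrivalStep (hist : Sched) (p : ℚ) (j : Fin m) : Set where
    smallA : let Lt = Lof (p ∷ map proj₁ hist) in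
             Small Lt p →
             InA j → loadSmall Lt hist j ≤ (c - 1ℚ) * Lt →
             (∀ j' → InA j' → loadSmall Lt hist j' ≤ (c - 1ℚ) * Lt → loadSmall Lt hist j ≤ loadSmall Lt hist j') →
             ArrivalStep hist p j
    smallB : let Lt = Lof (p ∷ map proj₁ hist) in
             Small Lt p →
             ¬ (Σ (Fin m) λ j' → InA j' × loadSmall Lt hist j' ≤ (c - 1ℚ) * Lt) →
             InB j → (∀ j' → InB j' → load hist j ≤ load hist j') →
             ArrivalStep hist p j
    largeA : let Lt = Lof (p ∷ map proj₁ hist) in
             ¬ Small Lt p →
             (Σ (Fin m) λ j' → InA j' × load hist j' ≤ ((+ 3 / 1) - c) * Lt) →
             InA j → (∀ j' → InA j' → load hist j ≤ load hist j') →
             ArrivalStep hist p j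
    largeB : let Lt = Lof (p ∷ map proj₁ hist) in
             ¬ Small Lt p →
             ¬ (Σ (Fin m) λ j' → InA j' × load hist j' ≤ ((+ 3 / 1) - c) * Lt) →
             InB j → (∀ j' → InB j' → load hist j ≤ load hist j') →
             ArrivalStep hist p j

  -- Arrival phase; job lists are stored latest-first (reversed arrival order).
  data Arrival : List ℚ → Sched → Set where
    []   : Arrival [] []
    step : ∀ {ps hist p j} → Arrival ps hist → ArrivalStep hist p j →
           Arrival (p ∷ ps) ((p , j) ∷ hist)

  data RemLargest (j : Fin m) : Sched → Sched → ℚ → Set where
    rem : ∀ xs ys p → All (λ x → proj₂ x ≡ j → proj₁ x ≤ p) (xs ++ (p , j) ∷ ys) →
          RemLargest j (xs ++ (p , j) ∷ ys) (xs ++ ys) p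

  data Phase1 : List (Fin m) → Sched → List ℚ → Sched → List ℚ → Set where
    done : ∀ {S R} → Phase1 [] S R S R
    remJ : ∀ {j js S S' p R S'' R''} → RemLargest j S S' p →
           Phase1 js S' (p ∷ R) S'' R'' → Phase1 (j ∷ js) S R S'' R''
    skip : ∀ {j js S R S'' R''} → All (λ x → proj₂ x ≢ j) S →
           Phase1 js S R S'' R'' → Phase1 (j ∷ js) S R S'' R''

  data Phase2 (L : ℚ) : Sched → List ℚ → Sched → List ℚ → Set where
    done : ∀ {S R} → (∀ j → InA j → load S j ≤ (c - 1ℚ) * L) → Phase2 L S R S R
    remJ : ∀ {j S S' p R S'' R''} → InA j → (c - 1ℚ) * L < load S j →
           RemLargest j S S' p → Phase2 L S' (p ∷ R) S'' R'' → Phase2 L S R S'' R''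

  data Reassign (L : ℚ) : List ℚ → Sched → Sched → Set where
    done : ∀ {S} → Reassign L [] S S
    toB  : ∀ {p ps S S' j} → InB j → load S j + p ≤ c * L →
           Reassign L ps ((p , j) ∷ S) S' → Reassign L (p ∷ ps) S S'
    toA  : ∀ {p ps S S' j} → (∀ j' → InB j' → c * L < load S j' + p) →
           InA j → (∀ j' → InA j' → load S j ≤ load S j') →
           Reassign L ps ((p , j) ∷ S) S' → Reassign L (p ∷ ps) S S'

  _≥_ : ℚ → ℚ → Set
  x ≥ y = y ≤ x

  data Run (σ : List ℚ) (S : Sched) : Set where
    run : ∀ {S₀ S₁ R₁ S₂ R₂ Rs} →
          Arrival (reverse σ) S₀ →
          Phase1 Bmachines S₀ [] S₁ R₁ →
          Phase2 (Lof σ) S₁ R₁ S₂ R₂ →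
          Rs ↭ R₂ → Linked _≥_ Rs →
          Reassign (Lof σ) Rs S₂ S →
          Run σ S

{-# OPTIONS --safe #-}
module Submission where

-- Let L be the final lower bound. On a machine of B, the load before its last job was at most (c - 1) L_t
-- if that job was large, and at most (3 - c) L_t if it was small, because A was already loaded then; so
-- removing the largest job leaves at most c L. In the reassignment, suppose a job p fits on no machine.
-- Then every machine has load above c L - p ≥ (c - 1) L, which forces p > L / 2, and every machine of A
-- has received a job of size at least p. If each machine of B has received such a job too, there are m + 1
-- jobs longer than L / 2, contradicting 2 p^{m+1} ≤ L. Otherwise some machine of B carries more than
-- (c - 1) L without its largest job, so its last job was small and arrived when every machine of A had
-- small load above (c - 1) L_t; as c ≥ 5/3, every machine of A keeps a load of at least (2 - c) L after
-- the removals, and the total load exceeds m L.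

open import Defs
open import Data.Bool using (if_then_else_; true; false)
open import Data.Empty using (⊥; ⊥-elim)
open import Data.Fin as Fin using (Fin; toℕ)
open import Data.Integer as ℤ using (+_)
import Data.Integer.Properties as ℤ
open import Data.List using (List; []; _∷_; _++_; map; foldr; reverse; allFin; length)
open import Data.List.Membership.Propositional using (_∈_)
open import Data.List.Membership.Propositional.Properties using (∈-allFin; ∈-map⁺; ∈-concatMap⁺; ∈-filter⁺)
open import Data.List.Properties using (unfold-reverse; map-id; map-++; ++-identityʳ)
open import Data.List.Relation.Binary.Permutation.Propositional using (_↭_; refl; prep; swap; trans; ↭-sym)
open import Data.List.Relation.Binary.Permutation.Propositional.Properties using (All-resp-↭; ↭-reverse; shift; map⁺; ++⁺ʳ; ++⁺ˡ; ∈-resp-↭)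
open import Data.List.Relation.Unary.All as All using (All; []; _∷_)
import Data.List.Relation.Unary.All.Properties as All
open import Data.List.Relation.Unary.AllPairs using (AllPairs; []; _∷_)
import Data.List.Relation.Unary.AllPairs.Properties as AllPairs
open import Data.List.Relation.Unary.Any as Any using (here; there)
open import Data.List.Relation.Unary.Linked as Linked using (Linked)
open import Data.List.Relation.Unary.Linked.Properties using (Linked⇒All; Linked⇒AllPairs)
open import Data.Nat using (ℕ; NonZero; zero; suc; ⌊_/2⌋)
import Data.Nat as ℕ
import Data.Nat.Properties as ℕ
open import Data.Product using (∃; _×_; _,_; proj₁; proj₂)
open import Data.Rational hiding (NonZero; _≥_)
open import Data.Rational.Properties
import Data.Rational.Unnormalised.Base as ℚᵘ
import Data.Rational.Unnormalised.Properties as ℚᵘ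
open import Algebra.Properties.CommutativeMonoid.Sum +-0-commutativeMonoid using (sum; sum-cong-≗; ∑-distrib-+; sum-replicate-zero)
open import Data.List.Sort ≤-decTotalOrder using (sort; sort-↭; sort-↗)
open import Data.Sum using (_⊎_; inj₁; inj₂; map₂)
open import Function using (flip; _∘_; id; case_of_)
import Level
open import Relation.Binary.PropositionalEquality hiding (trans)
import Relation.Binary.PropositionalEquality as ≡
open import Relation.Nullary using (yes; no; does)
open import Relation.Nullary.Decidable using (dec⇒maybe; from-yes; dec-true; dec-false)
open import Tactic.RingSolver using (solve-∀)
open import Tactic.RingSolver.Core.AlmostCommutativeRing using (AlmostCommutativeRing; fromCommutativeRing)

-- Order arithmetic and certificates for inequalities

ℚring : AlmostCommutativeRing Level.zero Level.zero
ℚring = fromCommutativeRing +-*-commutativeRing (λ x → dec⇒maybe (0ℚ ≟ x))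

≤⇒0≤- : ∀ {x y} → x ≤ y → 0ℚ ≤ y - x
≤⇒0≤- {x} {y} x≤y = subst (_≤ y - x) (+-inverseʳ x) (+-monoˡ-≤ (- x) x≤y)

<⇒0<- : ∀ {x y} → x < y → 0ℚ < y - x
<⇒0<- {x} {y} x<y = subst (_< y - x) (+-inverseʳ x) (+-monoˡ-< (- x) x<y)

0≤-⇒≤ : ∀ {x y} → 0ℚ ≤ y - x → x ≤ y
0≤-⇒≤ {x} {y} 0≤y-x = subst₂ _≤_ (+-identityʳ x) (eq x y) (+-monoʳ-≤ x 0≤y-x)
  where
  eq : ∀ x y → x + (y - x) ≡ y
  eq = solve-∀ ℚring

infix 5 _⊕<_
infixl 6 _⊕_
infixl 7 _⊗_ _⊗<_

-- Polynomial inequalities below are certified by writing the difference of the two sides as a sum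
-- of products of nonnegative terms; the ring solver checks the identity.
_⊕_ : ∀ {x y} → 0ℚ ≤ x → 0ℚ ≤ y → 0ℚ ≤ x + y
_⊕_ = +-mono-≤

_⊕<_ : ∀ {x y} → 0ℚ < x → 0ℚ ≤ y → 0ℚ < x + y
_⊕<_ = +-mono-<-≤

_⊗_ : ∀ {x y} → 0ℚ ≤ x → 0ℚ ≤ y → 0ℚ ≤ x * y
_⊗_ {x} {y} 0≤x 0≤y = nonNegative⁻¹ (x * y)
  {{nonNeg*nonNeg⇒nonNeg x {{nonNegative 0≤x}} y {{nonNegative 0≤y}}}}

_⊗<_ : ∀ {x y} → 0ℚ < x → 0ℚ < y → 0ℚ < x * y
_⊗<_ {x} {y} 0<x 0<y = positive⁻¹ (x * y) {{pos*pos⇒pos x {{positive 0<x}} y {{positive 0<y}}}}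

-- Ends proofs by contradiction: the negated goal and the hypotheses combine to a positive quantity
-- that a ring identity shows to be zero.
0<x⇒x≢0 : ∀ {x} → 0ℚ < x → x ≡ 0ℚ → ⊥
0<x⇒x≢0 0<x refl = <-irrefl refl 0<x

x≤x+y : ∀ {x y} → 0ℚ ≤ y → x ≤ x + y
x≤x+y {x} {y} 0≤y = subst (_≤ x + y) (+-identityʳ x) (+-monoʳ-≤ x 0≤y)

x≤y+x : ∀ {x y} → 0ℚ ≤ y → x ≤ y + x
x≤y+x {x} {y} 0≤y = subst (_≤ y + x) (+-identityˡ x) (+-monoˡ-≤ x 0≤y)

½+½ : ∀ x → ½ * x + ½ * x ≡ x
½+½ = solve-∀ ℚring

3ℚ : ℚ
3ℚ = + 3 / 1

-- Inequalities in the competitive ratio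

module Arithmetic {c : ℚ} (5/3≤c : + 5 / 3 ≤ c) (c≤2 : c ≤ + 2 / 1) where

  0≤c-5/3 : 0ℚ ≤ c - + 5 / 3
  0≤c-5/3 = ≤⇒0≤- 5/3≤c

  0≤2-c : 0ℚ ≤ + 2 / 1 - c
  0≤2-c = ≤⇒0≤- c≤2

  0<c-1 : 0ℚ < c - 1ℚ
  0<c-1 = <⇒0<- (<-≤-trans (from-yes (1ℚ <? + 5 / 3)) 5/3≤c)

  0≤c-1 : 0ℚ ≤ c - 1ℚ
  0≤c-1 = <⇒≤ 0<c-1

  0≤c-3/2 : 0ℚ ≤ c - + 3 / 2
  0≤c-3/2 = ≤⇒0≤- (≤-trans (from-yes (+ 3 / 2 ≤? + 5 / 3)) 5/3≤c)

  0<3-c : 0ℚ < 3ℚ - c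
  0<3-c = <⇒0<- (≤-<-trans c≤2 (from-yes (+ 2 / 1 <? 3ℚ)))

  0≤c : 0ℚ ≤ c
  0≤c = ≤-trans (from-yes (0ℚ ≤? + 5 / 3)) 5/3≤c

  [c-1]L≤cL : ∀ {L} → 0ℚ ≤ L → (c - 1ℚ) * L ≤ c * L
  [c-1]L≤cL {L} 0≤L = 0≤-⇒≤ (subst (0ℚ ≤_) (sym (eq c L)) 0≤L)
    where
    eq : ∀ c L → c * L - (c - 1ℚ) * L ≡ L
    eq = solve-∀ ℚring

  [3-c]L′≤cL : ∀ {L L′} → 0ℚ ≤ L → L′ ≤ L → (3ℚ - c) * L′ ≤ c * L
  [3-c]L′≤cL {L} {L′} 0≤L L′≤L = 0≤-⇒≤ (subst (0ℚ ≤_) (sym (eq c L L′))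
    ((from-yes (0ℚ ≤? + 2 / 1) ⊗ 0≤c-3/2) ⊗ 0≤L ⊕ <⇒≤ 0<3-c ⊗ ≤⇒0≤- L′≤L))
    where
    eq : ∀ c L L′ → c * L - (+ 3 / 1 - c) * L′ ≡
         (+ 2 / 1) * (c - + 3 / 2) * L + (+ 3 / 1 - c) * (L - L′)
    eq = solve-∀ ℚring

  [c-1]-mono : ∀ {L L′} → L′ ≤ L → (c - 1ℚ) * L′ ≤ (c - 1ℚ) * L
  [c-1]-mono = *-monoˡ-≤-nonNeg (c - 1ℚ) {{nonNegative 0≤c-1}}

  [2c-3]-mono : ∀ {L L′} → L′ ≤ L → (two * c - 3ℚ) * L′ ≤ (two * c - 3ℚ) * L
  [2c-3]-mono {L} {L′} L′≤L = 0≤-⇒≤ (subst (0ℚ ≤_) (sym (eq c L L′))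
    ((from-yes (0ℚ ≤? + 2 / 1) ⊗ 0≤c-3/2) ⊗ ≤⇒0≤- L′≤L))
    where
    eq : ∀ c L L′ → ((+ 2 / 1) * c - + 3 / 1) * L - ((+ 2 / 1) * c - + 3 / 1) * L′ ≡
         (+ 2 / 1) * (c - + 3 / 2) * (L - L′)
    eq = solve-∀ ℚring

  -- Since (c - 1) - (2 c - 3) = 2 - c, a machine above (c - 1) L that loses a small job q still
  -- carries at least (2 - c) L.
  L≤[2c-3]+[2-c] : ∀ {L ℓ q} → (c - 1ℚ) * L < q + ℓ → q ≤ (two * c - 3ℚ) * L →
                   (+ 2 / 1 - c) * L ≤ ℓ
  L≤[2c-3]+[2-c] {L} {ℓ} {q} load> q≤ = 0≤-⇒≤ (subst (0ℚ ≤_) (sym (eq c L ℓ q))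
    (≤⇒0≤- (<⇒≤ load>) ⊕ ≤⇒0≤- q≤))
    where
    eq : ∀ c L ℓ q → ℓ - (+ 2 / 1 - c) * L ≡
         (q + ℓ - (c - 1ℚ) * L) + (((+ 2 / 1) * c - + 3 / 1) * L - q)
    eq = solve-∀ ℚring

  -- (2 - c) (3 - c) ≤ (c - 1)² amounts to 5 ≤ 3 c.
  [2-c]L≤[c-1]x : ∀ {L x} → 0ℚ ≤ L → (c - 1ℚ) * L ≤ (3ℚ - c) * x → (+ 2 / 1 - c) * L ≤ (c - 1ℚ) * x
  [2-c]L≤[c-1]x {L} {x} 0≤L h = ≮⇒≥ λ lt → 0<x⇒x≢0
    (0<3-c ⊗< <⇒0<- lt ⊕< 0≤c-1 ⊗ ≤⇒0≤- h ⊕ from-yes (0ℚ ≤? + 3 / 1) ⊗ 0≤c-5/3 ⊗ 0≤L)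
    (eq c L x)
    where
    eq : ∀ c L x → (+ 3 / 1 - c) * ((+ 2 / 1 - c) * L - (c - 1ℚ) * x)
         + ((c - 1ℚ) * ((+ 3 / 1 - c) * x - (c - 1ℚ) * L) + (+ 3 / 1) * (c - + 5 / 3) * L) ≡ 0ℚ
    eq = solve-∀ ℚring

  -- In the next lemmas M is the number of machines and K the size of A.
  module Machines {M K : ℚ} (0≤K : 0ℚ ≤ K) (0<M-K : 0ℚ < M - K)
                  (0≤M-2K : 0ℚ ≤ M - K - K) (M-2K≤1 : M - K - K ≤ 1ℚ) where

    -- Here y is the least load on B while every machine of A has load at least (c - 1) L. As B has
    -- at least as many machines as A, the average load would exceed L if y were above (3 - c) L.
    least-load-small : ∀ {L p y} → 0ℚ ≤ L → 0ℚ ≤ p →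
      p + (K * ((c - 1ℚ) * L) + (M - K) * y) ≤ M * L → y ≤ (3ℚ - c) * L
    least-load-small {L} {p} {y} 0≤L 0≤p total = ≮⇒≥ λ lt → 0<x⇒x≢0
      (0<M-K ⊗< <⇒0<- lt ⊕< ≤⇒0≤- total ⊕ 0≤p ⊕ 0≤M-2K ⊗ (0≤2-c ⊗ 0≤L))
      (eq c M K L p y)
      where
      eq : ∀ c M K L p y → (M - K) * (y - (+ 3 / 1 - c) * L)
           + ((M * L - (p + (K * ((c - 1ℚ) * L) + (M - K) * y))) + p
           + (M - K - K) * ((+ 2 / 1 - c) * L)) ≡ 0ℚ
      eq = solve-∀ ℚring

    -- If B has one machine more than A, this costs at most (2 - c) L in the averaging. The large
    -- job contributes at least (2 c - 3) L, which covers the cost because 3 c ≥ 5.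
    least-load-large : ∀ {L p y} → 0ℚ ≤ L → (two * c - 3ℚ) * L ≤ p →
      p + (K * ((3ℚ - c) * L) + (M - K) * y) ≤ M * L → y ≤ (c - 1ℚ) * L
    least-load-large {L} {p} {y} 0≤L p≥ total = ≮⇒≥ λ lt → 0<x⇒x≢0
      (0<M-K ⊗< <⇒0<- lt ⊕< ≤⇒0≤- total ⊕ ≤⇒0≤- p≥
        ⊕ from-yes (0ℚ ≤? + 3 / 1) ⊗ 0≤c-5/3 ⊗ 0≤L ⊕ ≤⇒0≤- M-2K≤1 ⊗ (0≤2-c ⊗ 0≤L))
      (eq c M K L p y)
      where
      eq : ∀ c M K L p y → (M - K) * (y - (c - 1ℚ) * L)
           + ((M * L - (p + (K * ((+ 3 / 1 - c) * L) + (M - K) * y)))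
           + (p - ((+ 2 / 1) * c - + 3 / 1) * L)
           + (+ 3 / 1) * (c - + 5 / 3) * L
           + (1ℚ - (M - K - K)) * ((+ 2 / 1 - c) * L)) ≡ 0ℚ
      eq = solve-∀ ℚring

    -- With p ≤ L / 2 every load would be at least (c - 1/2) L ≥ L, which leaves no room for p in a
    -- total of M L.
    rejected⇒big : ∀ {L p} → 0ℚ ≤ L → 0ℚ < p →
      p + (K * (c * L - p) + (M - K) * (c * L - p)) ≤ M * L → ½ * L < p
    rejected⇒big {L} {p} 0≤L 0<p total = ≰⇒> λ p≤½L → 0<x⇒x≢0
      (0<p ⊕< ≤⇒0≤- total ⊕ 0≤M ⊗ (0≤c-3/2 ⊗ 0≤L) ⊕ 0≤M ⊗ ≤⇒0≤- p≤½L)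
      (eq c M K L p)
      where
      eq′ : ∀ M K → (M - K) + K ≡ M
      eq′ = solve-∀ ℚring
      0≤M : 0ℚ ≤ M
      0≤M = subst (0ℚ ≤_) (eq′ M K) (<⇒≤ 0<M-K ⊕ 0≤K)
      eq : ∀ c M K L p → p + ((M * L - (p + (K * (c * L - p) + (M - K) * (c * L - p))))
           + M * ((c - + 3 / 2) * L) + M * (½ * L - p)) ≡ 0ℚ
      eq = solve-∀ ℚring

    -- A machine of A and one of B together carry 2 L, so pairing them uses up 2 K L. If nothing
    -- else is left, p itself is in excess; if B has one machine more, that machine and p carry c L
    -- > L.
    rejected⇒overfull : ∀ {L p} → 0ℚ < p → p ≤ L →
      p + (K * (p + (+ 2 / 1 - c) * L) + (M - K) * (c * L - p)) ≤ M * L → ⊥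
    rejected⇒overfull {L} {p} 0<p p≤L total = 0<x⇒x≢0
      (0<p ⊗< 0<c-1 ⊕< <⇒≤ 0<p ⊗ (≤⇒0≤- M-2K≤1 ⊗ 0≤2-c)
        ⊕ 0≤M-2K ⊗ (0≤c-1 ⊗ ≤⇒0≤- p≤L) ⊕ ≤⇒0≤- total)
      (eq c M K L p)
      where
      eq : ∀ c M K L p → p * (c - 1ℚ) + (p * ((1ℚ - (M - K - K)) * (+ 2 / 1 - c))
           + (M - K - K) * ((c - 1ℚ) * (L - p))
           + (M * L - (p + (K * (p + (+ 2 / 1 - c) * L) + (M - K) * (c * L - p))))) ≡ 0ℚ
      eq = solve-∀ ℚring

-- Machine counts as rationals

-- Recursion makes `ι (suc n)` unfold to a ring expression, which the solver needs in inductions.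
ι : ℕ → ℚ
ι zero    = 0ℚ
ι (suc n) = 1ℚ + ι n

0≤1 : 0ℚ ≤ 1ℚ
0≤1 = from-yes (0ℚ ≤? 1ℚ)

0≤ι : ∀ n → 0ℚ ≤ ι n
0≤ι zero    = ≤-refl
0≤ι (suc n) = 0≤1 ⊕ 0≤ι n

0<ι : ∀ n → {{NonZero n}} → 0ℚ < ι n
0<ι (suc n) = from-yes (0ℚ <? 1ℚ) ⊕< 0≤ι n

-- Division of integers normalises its result, so the equality is checked on unnormalised fractions.
ι≡/1 : ∀ n → ι n ≡ + n / 1
ι≡/1 zero    = refl
ι≡/1 (suc n) = toℚᵘ-injective (begin
  toℚᵘ (1ℚ + ι n)                     ≈⟨ toℚᵘ-homo-+ 1ℚ (ι n) ⟩
  toℚᵘ 1ℚ ℚᵘ.+ toℚᵘ (ι n)             ≡⟨ cong (λ x → toℚᵘ 1ℚ ℚᵘ.+ toℚᵘ x) (ι≡/1 n) ⟩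
  toℚᵘ 1ℚ ℚᵘ.+ toℚᵘ (+ n / 1)         ≈⟨ ℚᵘ.+-congʳ (toℚᵘ 1ℚ) (toℚᵘ-fromℚᵘ (ℚᵘ.mkℚᵘ (+ n) 0)) ⟩
  toℚᵘ 1ℚ ℚᵘ.+ ℚᵘ.mkℚᵘ (+ n) 0        ≈⟨ ℚᵘ.*≡* (cong (λ x → (ℤ.1ℤ ℤ.+ x) ℤ.* ℤ.1ℤ) (ℤ.*-identityʳ (+ n))) ⟩
  ℚᵘ.mkℚᵘ (+ suc n) 0                 ≈⟨ toℚᵘ-fromℚᵘ (ℚᵘ.mkℚᵘ (+ suc n) 0) ⟨
  toℚᵘ (+ suc n / 1)                  ∎)
  where open ℚᵘ.≃-Reasoning

1/n*ι : ∀ n → {{_ : NonZero n}} → + 1 / n * ι n ≡ 1ℚ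
1/n*ι (suc n) = ≡.trans (cong (+ 1 / suc n *_) (ι≡/1 (suc n))) (toℚᵘ-injective (begin
  toℚᵘ (+ 1 / suc n * (+ suc n / 1))            ≈⟨ toℚᵘ-homo-* (+ 1 / suc n) (+ suc n / 1) ⟩
  toℚᵘ (+ 1 / suc n) ℚᵘ.* toℚᵘ (+ suc n / 1)    ≈⟨ ℚᵘ.*-cong (toℚᵘ-fromℚᵘ (ℚᵘ.mkℚᵘ (+ 1) n)) (toℚᵘ-fromℚᵘ (ℚᵘ.mkℚᵘ (+ suc n) 0)) ⟩
  ℚᵘ.mkℚᵘ (+ 1) n ℚᵘ.* ℚᵘ.mkℚᵘ (+ suc n) 0      ≈⟨ ℚᵘ.*≡* cross ⟩
  toℚᵘ 1ℚ                                       ∎))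
  where
  open ℚᵘ.≃-Reasoning
  cross : + 1 ℤ.* + suc n ℤ.* + 1 ≡ + 1 ℤ.* + (suc n ℕ.* 1)
  cross = ≡.trans (ℤ.*-comm (+ 1 ℤ.* + suc n) (+ 1)) (cong (λ x → + 1 ℤ.* x)
    (≡.trans (ℤ.*-identityˡ (+ suc n)) (cong (λ k → + k) (sym (ℕ.*-identityʳ (suc n))))))

-- The quantity is the parity of n, unchanged when n grows by 2. It counts by how many machines B
-- exceeds A.
0≤ι-2ι½ : ∀ n → 0ℚ ≤ ι n - ι ⌊ n /2⌋ - ι ⌊ n /2⌋
0≤ι-2ι½ zero          = ≤-refl
0≤ι-2ι½ (suc zero)    = 0≤1
0≤ι-2ι½ (suc (suc n)) = subst (0ℚ ≤_) (eq (ι n) (ι ⌊ n /2⌋)) (0≤ι-2ι½ n)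
  where
  eq : ∀ x y → x - y - y ≡ 1ℚ + (1ℚ + x) - (1ℚ + y) - (1ℚ + y)
  eq = solve-∀ ℚring

ι-2ι½≤1 : ∀ n → ι n - ι ⌊ n /2⌋ - ι ⌊ n /2⌋ ≤ 1ℚ
ι-2ι½≤1 zero          = 0≤1
ι-2ι½≤1 (suc zero)    = ≤-refl
ι-2ι½≤1 (suc (suc n)) = subst (_≤ 1ℚ) (eq (ι n) (ι ⌊ n /2⌋)) (ι-2ι½≤1 n)
  where
  eq : ∀ x y → x - y - y ≡ 1ℚ + (1ℚ + x) - (1ℚ + y) - (1ℚ + y)
  eq = solve-∀ ℚring

0<ι-ι½ : ∀ n → {{NonZero n}} → 0ℚ < ι n - ι ⌊ n /2⌋
0<ι-ι½ (suc zero)      = from-yes (0ℚ <? 1ℚ)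
0<ι-ι½ (suc (suc n)) with n
... | zero  = from-yes (0ℚ <? 1ℚ)
... | suc k = subst (0ℚ <_) (eq (ι (suc k)) (ι ⌊ suc k /2⌋)) (from-yes (0ℚ <? 1ℚ) ⊕< <⇒≤ (0<ι-ι½ (suc k)))
  where
  eq : ∀ x y → 1ℚ + (x - y) ≡ 1ℚ + (1ℚ + x) - (1ℚ + y)
  eq = solve-∀ ℚring

-- Bounds for sums over machines

sum-≤ : ∀ {n} (f : Fin n → ℚ) {b} → (∀ j → f j ≤ b) → sum f ≤ ι n * b
sum-≤ {zero}  f {b} f≤b = ≤-reflexive (sym (*-zeroˡ b))
sum-≤ {suc n} f {b} f≤b = ≤-trans (+-mono-≤ (f≤b Fin.zero) (sum-≤ (f ∘ Fin.suc) (f≤b ∘ Fin.suc)))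
  (≤-reflexive (eq (ι n) b))
  where
  eq : ∀ n b → b + n * b ≡ (1ℚ + n) * b
  eq = solve-∀ ℚring

≤-sum : ∀ {n} (f : Fin n → ℚ) {b} → (∀ j → b ≤ f j) → ι n * b ≤ sum f
≤-sum {zero}  f {b} b≤f = ≤-reflexive (*-zeroˡ b)
≤-sum {suc n} f {b} b≤f = ≤-trans (≤-reflexive (eq (ι n) b))
  (+-mono-≤ (b≤f Fin.zero) (≤-sum (f ∘ Fin.suc) (b≤f ∘ Fin.suc)))
  where
  eq : ∀ n b → (1ℚ + n) * b ≡ b + n * b
  eq = solve-∀ ℚring

-- A is an initial segment of the machines, so induction on its size k peels off one machine of A at
-- a time and leaves B for the base case.
split-≤-sum : ∀ {n} k (f : Fin n → ℚ) {a b} → k ℕ.≤ n →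
              (∀ j → toℕ j ℕ.< k → a ≤ f j) → (∀ j → k ℕ.≤ toℕ j → b ≤ f j) →
              ι k * a + (ι n - ι k) * b ≤ sum f
split-≤-sum {n} zero f {a} {b} _ _ b≤f =
  ≤-trans (≤-reflexive (eq (ι n) a b)) (≤-sum f (λ j → b≤f j ℕ.z≤n))
  where
  eq : ∀ n a b → 0ℚ * a + (n - 0ℚ) * b ≡ n * b
  eq = solve-∀ ℚring
split-≤-sum {suc n} (suc k) f {a} {b} (ℕ.s≤s k≤n) a≤f b≤f = ≤-trans (≤-reflexive (eq (ι n) (ι k) a b))
  (+-mono-≤ (a≤f Fin.zero (ℕ.s≤s ℕ.z≤n))
    (split-≤-sum k (f ∘ Fin.suc) k≤n (λ j → a≤f (Fin.suc j) ∘ ℕ.s≤s) (λ j → b≤f (Fin.suc j) ∘ ℕ.s≤s)))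
  where
  eq : ∀ n k a b → (1ℚ + k) * a + (1ℚ + n - (1ℚ + k)) * b ≡ a + (k * a + (n - k) * b)
  eq = solve-∀ ℚring

sum-single : ∀ {n} (i : Fin n) x → sum (λ j → if does (i Fin.≟ j) then x else 0ℚ) ≡ x
sum-single {suc n} Fin.zero    x = ≡.trans (cong (λ y → x + y) (sum-replicate-zero n)) (+-identityʳ x)
sum-single {suc n} (Fin.suc i) x = ≡.trans (+-identityˡ _) (sum-single i x)

-- Weighted totals and the number of long jobs

-- The general weight serves both processing times (`id`) and counts (`above x`).
total : (ℚ → ℚ) → List ℚ → ℚ
total w ps = sumℚ (map w ps)

total-↭ : ∀ w {ps qs} → ps ↭ qs → total w ps ≡ total w qs
total-↭ w refl           = refl
total-↭ w (prep p r)     = cong (λ x → w p + x) (total-↭ w r)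
total-↭ w {p ∷ q ∷ ps} {_ ∷ _ ∷ qs} (swap p q r) =
  ≡.trans (eq (w p) (w q) (total w ps)) (cong (λ x → w q + (w p + x)) (total-↭ w r))
  where
  eq : ∀ a b x → a + (b + x) ≡ b + (a + x)
  eq = solve-∀ ℚring
total-↭ w (trans r s)    = ≡.trans (total-↭ w r) (total-↭ w s)

0≤total : ∀ w {ps} → All (λ p → 0ℚ ≤ w p) ps → 0ℚ ≤ total w ps
0≤total w []        = ≤-refl
0≤total w (p ∷ ps)  = p ⊕ 0≤total w ps

-- total (above x) counts the jobs longer than x.
above : ℚ → ℚ → ℚ
above x p = if does (x <? p) then 1ℚ else 0ℚ

above-yes : ∀ {x p} → x < p → above x p ≡ 1ℚ
above-yes {x} {p} x<p = cong (λ b → if b then 1ℚ else 0ℚ) (dec-true (x <? p) x<p)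

above-no : ∀ {x p} → p ≤ x → above x p ≡ 0ℚ
above-no {x} {p} p≤x = cong (λ b → if b then 1ℚ else 0ℚ)
  (dec-false (x <? p) (λ x<p → <-irrefl refl (<-≤-trans x<p p≤x)))

0≤above : ∀ x p → 0ℚ ≤ above x p
0≤above x p with x <? p
... | yes x<p = subst (0ℚ ≤_) (sym (above-yes x<p)) 0≤1
... | no x≮p  = ≤-reflexive (sym (above-no (≮⇒≥ x≮p)))

above≤1 : ∀ x p → above x p ≤ 1ℚ
above≤1 x p with x <? p
... | yes x<p = ≤-reflexive (above-yes x<p)
... | no x≮p  = subst (_≤ 1ℚ) (sym (above-no (≮⇒≥ x≮p))) 0≤1

total-above≡0 : ∀ {x ps} → All (_≤ x) ps → total (above x) ps ≡ 0ℚ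
total-above≡0 []          = refl
total-above≡0 (p≤x ∷ ps≤) = cong₂ _+_ (above-no p≤x) (total-above≡0 ps≤)

0≤total-above : ∀ x ps → 0ℚ ≤ total (above x) ps
0≤total-above x ps = 0≤total (above x) (All.universal (0≤above x) ps)

nth-≤ : ∀ {x ps} i → 0ℚ ≤ x → All (_≤ x) ps → nth i ps ≤ x
nth-≤ i       0≤x []           = 0≤x
nth-≤ zero    0≤x (p≤x ∷ _)    = p≤x
nth-≤ (suc i) 0≤x (_ ∷ ps≤x)   = nth-≤ i 0≤x ps≤x

+-cancelˡ-≤ : ∀ x {y z} → x + y ≤ x + z → y ≤ z
+-cancelˡ-≤ x {y} {z} h = 0≤-⇒≤ (subst (0ℚ ≤_) (eq x y z) (≤⇒0≤- h))
  where
  eq : ∀ x y z → x + z - (x + y) ≡ z - y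
  eq = solve-∀ ℚring

-- In a descending list the entries above x form a prefix, and position i, counted from 0, lies
-- beyond a prefix of length at most i. The bound 0 ≤ x handles the default value of `nth` out of
-- range.
few-above⇒nth≤ : ∀ {x ps} i → AllPairs (flip _≤_) ps → 0ℚ ≤ x → total (above x) ps ≤ ι i → nth i ps ≤ x
few-above⇒nth≤ i [] 0≤x _ = 0≤x
few-above⇒nth≤ {x} {p ∷ ps} i (p≥ ∷ desc) 0≤x few with x <? p
few-above⇒nth≤ {x} {p ∷ ps} i (p≥ ∷ desc) 0≤x few | no x≮p =
  nth-≤ i 0≤x (≮⇒≥ x≮p ∷ All.map (λ q≤p → ≤-trans q≤p (≮⇒≥ x≮p)) p≥)
few-above⇒nth≤ {x} {p ∷ ps} zero (p≥ ∷ desc) 0≤x few | yes x<p =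
  ⊥-elim (<-irrefl refl (<-≤-trans (from-yes (0ℚ <? 1ℚ) ⊕< 0≤total-above x ps)
    (subst (λ a → a + total (above x) ps ≤ 0ℚ) (above-yes x<p) few)))
few-above⇒nth≤ {x} {p ∷ ps} (suc i) (p≥ ∷ desc) 0≤x few | yes x<p =
  few-above⇒nth≤ i desc 0≤x (+-cancelˡ-≤ 1ℚ
    (subst (λ a → a + total (above x) ps ≤ 1ℚ + ι i) (above-yes x<p) few))

nth≤⇒few-above : ∀ {x ps} i → AllPairs (flip _≤_) ps → nth i ps ≤ x → total (above x) ps ≤ ι i
nth≤⇒few-above i [] _ = 0≤ι i
nth≤⇒few-above zero (p≥ ∷ _) p≤x =
  ≤-reflexive (total-above≡0 (p≤x ∷ All.map (λ q≤p → ≤-trans q≤p p≤x) p≥))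
nth≤⇒few-above {x} {p ∷ ps} (suc i) (_ ∷ desc) h =
  +-mono-≤ (above≤1 x p) (nth≤⇒few-above i desc h)

reverse-AllPairs : ∀ {a ℓ} {A : Set a} {R : A → A → Set ℓ} {xs} →
                   AllPairs R xs → AllPairs (flip R) (reverse xs)
reverse-AllPairs [] = []
reverse-AllPairs {R = R} {xs = x ∷ xs} (px ∷ pxs) = subst (AllPairs (flip R)) (sym (unfold-reverse x xs))
  (AllPairs.++⁺ (reverse-AllPairs pxs) ([] ∷ [])
    (All.map (λ r → r ∷ []) (All-resp-↭ (↭-sym (↭-reverse xs)) px)))

sortDesc-↭ : ∀ ps → sortDesc ps ↭ ps
sortDesc-↭ ps = trans (↭-reverse (sort ps)) (sort-↭ ps)

sortDesc-↘ : ∀ ps → AllPairs (flip _≤_) (sortDesc ps)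
sortDesc-↘ ps = reverse-AllPairs (Linked⇒AllPairs ≤-trans (sort-↗ ps))

few-above⇒largest≤ : ∀ {x} i ps → 0ℚ ≤ x → total (above x) ps ≤ ι i → largest i ps ≤ x
few-above⇒largest≤ {x} i ps 0≤x few = few-above⇒nth≤ i (sortDesc-↘ ps) 0≤x
  (≤-trans (≤-reflexive (total-↭ (above x) (sortDesc-↭ ps))) few)

largest≤⇒few-above : ∀ {x} i ps → largest i ps ≤ x → total (above x) ps ≤ ι i
largest≤⇒few-above {x} i ps h = ≤-trans
  (≤-reflexive (total-↭ (above x) (↭-sym (sortDesc-↭ ps)))) (nth≤⇒few-above i (sortDesc-↘ ps) h)

≤largest : ∀ ps → All (_≤ largest 0 ps) ps
≤largest ps = All-resp-↭ (sortDesc-↭ ps) (≤head (sortDesc-↘ ps))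
  where
  ≤head : ∀ {qs} → AllPairs (flip _≤_) qs → All (_≤ nth 0 qs) qs
  ≤head []       = []
  ≤head (q≥ ∷ _) = ≤-refl ∷ q≥

largest0≤ : ∀ {x ps} → 0ℚ ≤ x → All (_≤ x) ps → largest 0 ps ≤ x
largest0≤ {x} {ps} 0≤x ps≤x = nth-≤ 0 0≤x (All-resp-↭ (↭-sym (sortDesc-↭ ps)) ps≤x)

-- The lower bound characterised by three conditions

-- The lower bound Lof is the least nonnegative X satisfying these three conditions.
record Fits (m : ℕ) (X : ℚ) (ps : List ℚ) : Set where
  constructor fits
  field
    average : sumℚ ps ≤ ι m * X
    each    : All (_≤ X) ps
    few-big : total (above (½ * X)) ps ≤ ι m

open Fits

sumℚ-↭ : ∀ {ps qs} → ps ↭ qs → sumℚ ps ≡ sumℚ qs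
sumℚ-↭ {ps} {qs} r = subst₂ (λ x y → sumℚ x ≡ sumℚ y) (map-id ps) (map-id qs) (total-↭ id r)

Fits-↭ : ∀ {m X ps qs} → ps ↭ qs → Fits m X ps → Fits m X qs
Fits-↭ {m} {X} r (fits avg e big) = fits (subst (_≤ ι m * X) (sumℚ-↭ r) avg) (All-resp-↭ r e)
  (subst (_≤ ι m) (total-↭ (above (½ * X)) r) big)

Fits-tail : ∀ {m X p ps} → 0ℚ ≤ p → Fits m X (p ∷ ps) → Fits m X ps
Fits-tail {X = X} {p} {ps} 0≤p (fits avg (_ ∷ e) big) =
  fits (≤-trans (x≤y+x 0≤p) avg) e (≤-trans (x≤y+x (0≤above (½ * X) p)) big)

module LowerBound (m : ℕ) {{nz : NonZero m}} (c : ℚ) where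
  open Alg m c using (Lof)

  private
    sum/m*m : ∀ s → s * (+ 1 / m) * ι m ≡ s
    sum/m*m s = ≡.trans (*-assoc s (+ 1 / m) (ι m)) (≡.trans (cong (s *_) (1/n*ι m)) (*-identityʳ s))

    halve : ∀ {x y} → two * x ≤ y → x ≤ ½ * y
    halve {x} h = ≤-trans (≤-reflexive (eq x)) (*-monoˡ-≤-nonNeg ½ h)
      where
      eq : ∀ x → x ≡ ½ * ((+ 2 / 1) * x)
      eq = solve-∀ ℚring

    double : ∀ {x y} → x ≤ ½ * y → two * x ≤ y
    double {x} {y} h = ≤-trans (*-monoˡ-≤-nonNeg (+ 2 / 1) h) (≤-reflexive (eq y))
      where
      eq : ∀ y → (+ 2 / 1) * (½ * y) ≡ y
      eq = solve-∀ ℚring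

    0≤½* : ∀ {x} → 0ℚ ≤ x → 0ℚ ≤ ½ * x
    0≤½* 0≤x = from-yes (0ℚ ≤? ½) ⊗ 0≤x

  Lof-Fits : ∀ ps → Fits m (Lof ps) ps
  Lof-Fits ps = fits
    (≤-trans (≤-reflexive (sym (sum/m*m (sumℚ ps))))
      (≤-trans (*-monoʳ-≤-nonNeg (ι m) {{nonNegative (0≤ι m)}} avg≤L) (≤-reflexive (*-comm (Lof ps) (ι m)))))
    (All.map (λ p≤ → ≤-trans p≤ (≤-trans (p≤q⊔p avg (largest 0 ps)) (p≤p⊔q _ _))) (≤largest ps))
    (largest≤⇒few-above m ps (halve (p≤q⊔p (avg ⊔ largest 0 ps) (two * largest m ps))))
    where
    avg = sumℚ ps * (+ 1 / m)
    avg≤L : avg ≤ Lof ps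
    avg≤L = ≤-trans (p≤p⊔q avg (largest 0 ps)) (p≤p⊔q _ _)

  -- Comparisons with `Lof` reduce to checking `Fits`, which avoids reasoning about sorted lists
  -- when jobs are added or permuted, and when schedules are compared with the bound.
  Lof-least : ∀ {X} ps → 0ℚ ≤ X → Fits m X ps → Lof ps ≤ X
  Lof-least {X} ps 0≤X (fits avg e big) = ⊔-lub
    (⊔-lub
      (*-cancelʳ-≤-pos {sumℚ ps * (+ 1 / m)} {X} (ι m) {{positive (0<ι m)}}
        (≤-trans (≤-reflexive (sum/m*m (sumℚ ps))) (≤-trans avg (≤-reflexive (*-comm (ι m) X)))))
      (largest0≤ 0≤X e))
    (double (few-above⇒largest≤ m ps (0≤½* 0≤X) big))

  Fits⇒0≤ : ∀ {X ps} → All (0ℚ ≤_) ps → Fits m X ps → 0ℚ ≤ X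
  Fits⇒0≤ {X} {ps} 0≤ps f = *-cancelˡ-≤-pos (ι m) {{positive (0<ι m)}}
    (≤-trans (≤-reflexive (*-zeroʳ (ι m))) (≤-trans (0≤sum 0≤ps) (average f)))
    where
    0≤sum : ∀ {ps} → All (0ℚ ≤_) ps → 0ℚ ≤ sumℚ ps
    0≤sum []       = ≤-refl
    0≤sum (p ∷ ps) = p ⊕ 0≤sum ps

-- Weighted loads of machines

jobs : ∀ {m} → List (ℚ × Fin m) → List ℚ
jobs = map proj₁

module _ {m : ℕ} where

  -- One notion covers `load`, `loadSmall` and the number of long jobs on a machine, through the
  -- weights `id`, `smallPart` and `above`.
  wload : (ℚ → ℚ) → List (ℚ × Fin m) → Fin m → ℚ
  wload w []            j = 0ℚ
  wload w ((p , i) ∷ S) j = if does (i Fin.≟ j) then w p + wload w S j else wload w S j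

  wload-here : ∀ w p S j → wload w ((p , j) ∷ S) j ≡ w p + wload w S j
  wload-here w p S j = cong (λ b → if b then w p + wload w S j else wload w S j) (dec-true (j Fin.≟ j) refl)

  wload-there : ∀ w p S {i j} → i ≢ j → wload w ((p , i) ∷ S) j ≡ wload w S j
  wload-there w p S {i} {j} i≢j =
    cong (λ b → if b then w p + wload w S j else wload w S j) (dec-false (i Fin.≟ j) i≢j)

  -- Turns the conditional into a summand, so that two insertions commute and the sum over all
  -- machines distributes.
  wload-∷ : ∀ w p S i j → wload w ((p , i) ∷ S) j ≡ (if does (i Fin.≟ j) then w p else 0ℚ) + wload w S j
  wload-∷ w p S i j with does (i Fin.≟ j)
  ... | true  = refl
  ... | false = sym (+-identityˡ (wload w S j))

  wload-↭ : ∀ w {S T} → S ↭ T → ∀ j → wload w S j ≡ wload w T j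
  wload-↭ w refl j = refl
  wload-↭ w (prep (p , i) r) j =
    cong (λ x → if does (i Fin.≟ j) then w p + x else x) (wload-↭ w r j)
  wload-↭ w (swap {xs = S} {ys = T} (p , i) (q , k) r) j = begin
    wload w ((p , i) ∷ (q , k) ∷ S) j  ≡⟨ wload-∷ w p ((q , k) ∷ S) i j ⟩
    a + wload w ((q , k) ∷ S) j        ≡⟨ cong (λ x → a + x) (wload-∷ w q S k j) ⟩
    a + (b + wload w S j)              ≡⟨ cong (λ x → a + (b + x)) (wload-↭ w r j) ⟩
    a + (b + wload w T j)              ≡⟨ eq a b (wload w T j) ⟩
    b + (a + wload w T j)              ≡⟨ cong (λ x → b + x) (wload-∷ w p T i j) ⟨
    b + wload w ((p , i) ∷ T) j        ≡⟨ wload-∷ w q ((p , i) ∷ T) k j ⟨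
    wload w ((q , k) ∷ (p , i) ∷ T) j  ∎
    where
    open ≡-Reasoning
    a = if does (i Fin.≟ j) then w p else 0ℚ
    b = if does (k Fin.≟ j) then w q else 0ℚ
    eq : ∀ a b x → a + (b + x) ≡ b + (a + x)
    eq = solve-∀ ℚring
  wload-↭ w (trans r s) j = ≡.trans (wload-↭ w r j) (wload-↭ w s j)

  sum-wload : ∀ w S → sum (wload w S) ≡ total w (jobs S)
  sum-wload w []            = sum-replicate-zero m
  sum-wload w ((p , i) ∷ S) = begin
    sum (wload w ((p , i) ∷ S))        ≡⟨ sum-cong-≗ (wload-∷ w p S i) ⟩
    sum (λ j → single j + wload w S j) ≡⟨ ∑-distrib-+ single (wload w S) ⟩
    sum single + sum (wload w S)       ≡⟨ cong₂ _+_ (sum-single i (w p)) (sum-wload w S) ⟩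
    w p + total w (jobs S)             ∎
    where
    open ≡-Reasoning
    single = λ j → if does (i Fin.≟ j) then w p else 0ℚ

  wload-≤-∷ : ∀ w {p} S i j → 0ℚ ≤ w p → wload w S j ≤ wload w ((p , i) ∷ S) j
  wload-≤-∷ w S i j 0≤wp with does (i Fin.≟ j)
  ... | true  = x≤y+x 0≤wp
  ... | false = ≤-refl

  0≤wload : ∀ w {S} j → All (λ p → 0ℚ ≤ w p) (jobs S) → 0ℚ ≤ wload w S j
  0≤wload w {[]}          j []           = ≤-refl
  0≤wload w {(p , i) ∷ S} j (0≤wp ∷ 0≤w) = ≤-trans (0≤wload w j 0≤w) (wload-≤-∷ w S i j 0≤wp)

  wload-mono : ∀ w v {S} j → All (λ p → w p ≤ v p) (jobs S) → wload w S j ≤ wload v S j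
  wload-mono w v {[]}          j []        = ≤-refl
  wload-mono w v {(p , i) ∷ S} j (w≤v ∷ h) with does (i Fin.≟ j)
  ... | true  = +-mono-≤ w≤v (wload-mono w v j h)
  ... | false = wload-mono w v j h

  ≤wload : ∀ w {S p j} → All (λ p → 0ℚ ≤ w p) (jobs S) → (p , j) ∈ S → w p ≤ wload w S j
  ≤wload w {(p , j) ∷ S} (_ ∷ 0≤w)     (here refl) =
    ≤-trans (x≤x+y (0≤wload w j 0≤w)) (≤-reflexive (sym (wload-here w p S j)))
  ≤wload w {(q , i) ∷ S} (0≤wq ∷ 0≤w)  (there p∈S) = ≤-trans (≤wload w 0≤w p∈S) (wload-≤-∷ w S i _ 0≤wq)

  wload-absent : ∀ w {S j} → All (λ x → proj₂ x ≢ j) S → wload w S j ≡ 0ℚ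
  wload-absent w []                            = refl
  wload-absent w {(p , i) ∷ S} (i≢j ∷ absent)  = ≡.trans (wload-there w p S i≢j) (wload-absent w absent)

smallPart : ℚ → ℚ → ℚ
smallPart τ p = if does (p ≤? τ) then p else 0ℚ

smallPart-large : ∀ {τ p} → τ < p → smallPart τ p ≡ 0ℚ
smallPart-large {τ} {p} τ<p = cong (λ b → if b then p else 0ℚ)
  (dec-false (p ≤? τ) (λ p≤τ → <-irrefl refl (<-≤-trans τ<p p≤τ)))

0≤smallPart : ∀ {τ p} → 0ℚ ≤ p → 0ℚ ≤ smallPart τ p
0≤smallPart {τ} {p} 0≤p with does (p ≤? τ)
... | true  = 0≤p
... | false = ≤-refl

smallPart≤ : ∀ {τ p} → 0ℚ ≤ p → smallPart τ p ≤ p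
smallPart≤ {τ} {p} 0≤p with does (p ≤? τ)
... | true  = ≤-refl
... | false = 0≤p

-- Bounds for maxima and minima of lists

≤maxℚ : ∀ {x xs} → x ∈ xs → x ≤ maxℚ xs
≤maxℚ {xs = y ∷ ys} (here refl)  = p≤p⊔q y (maxℚ ys)
≤maxℚ {xs = y ∷ ys} (there x∈ys) = ≤-trans (≤maxℚ x∈ys) (p≤q⊔p y (maxℚ ys))

maxℚ≤ : ∀ {X xs} → 0ℚ ≤ X → All (_≤ X) xs → maxℚ xs ≤ X
maxℚ≤ 0≤X []          = 0≤X
maxℚ≤ 0≤X (x≤ ∷ xs≤)  = ⊔-lub x≤ (maxℚ≤ 0≤X xs≤)

≤minℚ : ∀ {X x xs} → x ∈ xs → All (X ≤_) xs → X ≤ minℚ xs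
≤minℚ {xs = _ ∷ _} _ (X≤x ∷ X≤xs) = go X≤x X≤xs
  where
  go : ∀ {X x xs} → X ≤ x → All (X ≤_) xs → X ≤ foldr _⊓_ x xs
  go X≤x []           = X≤x
  go X≤x (X≤y ∷ X≤ys) = ⊓-glb X≤y (go X≤x X≤ys)

-- Schedules and the comparison of L with the optimum

module Schedules (m : ℕ) {{nz : NonZero m}} (c : ℚ) where
  open Alg m c
  open LowerBound m c

  load≡wload : ∀ S j → load S j ≡ wload id S j
  load≡wload []            j = refl
  load≡wload ((p , i) ∷ S) j = cong (λ x → if does (i Fin.≟ j) then p + x else x) (load≡wload S j)

  threshold : ℚ → ℚ
  threshold L = (two * c - 3ℚ) * L

  small : ℚ → ℚ → ℚ
  small L = smallPart (threshold L)

  loadSmall≡wload : ∀ L S j → loadSmall L S j ≡ wload (small L) S j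
  loadSmall≡wload L []            j = refl
  loadSmall≡wload L ((p , i) ∷ S) j = ≡.trans
    (cong (λ x → if does (i Fin.≟ j) then (if does (p ≤? threshold L) then p + x else x) else x)
      (loadSmall≡wload L S j))
    (cong (λ x → if does (i Fin.≟ j) then x else s) (push (does (p ≤? threshold L))))
    where
    s = wload (small L) S j
    push : ∀ b → (if b then p + s else s) ≡ (if b then p else 0ℚ) + s
    push true  = refl
    push false = sym (+-identityˡ s)

  load-here : ∀ p S j → load ((p , j) ∷ S) j ≡ p + load S j
  load-here p S j rewrite load≡wload ((p , j) ∷ S) j | load≡wload S j = wload-here id p S j

  load-there : ∀ p S {i j} → i ≢ j → load ((p , i) ∷ S) j ≡ load S j
  load-there p S {i} {j} i≢j rewrite load≡wload ((p , i) ∷ S) j | load≡wload S j = wload-there id p S i≢j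

  load-↭ : ∀ {S T} → S ↭ T → ∀ j → load S j ≡ load T j
  load-↭ {S} {T} r j rewrite load≡wload S j | load≡wload T j = wload-↭ id r j

  loadSmall-↭ : ∀ L {S T} → S ↭ T → ∀ j → loadSmall L S j ≡ loadSmall L T j
  loadSmall-↭ L {S} {T} r j rewrite loadSmall≡wload L S j | loadSmall≡wload L T j = wload-↭ (small L) r j

  loadSmall-there : ∀ L p S {i j} → i ≢ j → loadSmall L ((p , i) ∷ S) j ≡ loadSmall L S j
  loadSmall-there L p S {i} {j} i≢j
    rewrite loadSmall≡wload L ((p , i) ∷ S) j | loadSmall≡wload L S j = wload-there (small L) p S i≢j

  loadSmall-large : ∀ L {p} S j → threshold L < p → loadSmall L ((p , j) ∷ S) j ≡ loadSmall L S j
  loadSmall-large L {p} S j large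
    rewrite loadSmall≡wload L ((p , j) ∷ S) j | loadSmall≡wload L S j = begin
      wload (small L) ((p , j) ∷ S) j        ≡⟨ wload-here (small L) p S j ⟩
      small L p + wload (small L) S j    ≡⟨ cong (_+ wload (small L) S j) (smallPart-large {threshold L} large) ⟩
      0ℚ + wload (small L) S j               ≡⟨ +-identityˡ _ ⟩
      wload (small L) S j                    ∎
    where open ≡-Reasoning

  load-≤-∷ : ∀ {p} S i j → 0ℚ ≤ p → load S j ≤ load ((p , i) ∷ S) j
  load-≤-∷ {p} S i j 0≤p rewrite load≡wload ((p , i) ∷ S) j | load≡wload S j = wload-≤-∷ id S i j 0≤p

  loadSmall-≤-∷ : ∀ L {p} S i j → 0ℚ ≤ p → loadSmall L S j ≤ loadSmall L ((p , i) ∷ S) j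
  loadSmall-≤-∷ L {p} S i j 0≤p rewrite loadSmall≡wload L ((p , i) ∷ S) j | loadSmall≡wload L S j =
    wload-≤-∷ (small L) {p} S i j (0≤smallPart {threshold L} {p} 0≤p)

  loadSmall≤load : ∀ L {S} j → All (0ℚ ≤_) (jobs S) → loadSmall L S j ≤ load S j
  loadSmall≤load L {S} j 0≤S rewrite loadSmall≡wload L S j | load≡wload S j =
    wload-mono (small L) id j (All.map (smallPart≤ {threshold L}) 0≤S)

  load-absent : ∀ {S j} → All (λ x → proj₂ x ≢ j) S → load S j ≡ 0ℚ
  load-absent {S} {j} absent = ≡.trans (load≡wload S j) (wload-absent id absent)

  sum-load : ∀ S → sum (load S) ≡ sumℚ (jobs S)
  sum-load S = ≡.trans (sum-cong-≗ (load≡wload S)) (≡.trans (sum-wload id S) (cong sumℚ (map-id (jobs S))))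

  load≤makespan : ∀ S j → load S j ≤ makespan S
  load≤makespan S j = ≤maxℚ (∈-map⁺ (load S) (∈-allFin j))

  makespan≤ : ∀ {X} S → 0ℚ ≤ X → (∀ j → load S j ≤ X) → makespan S ≤ X
  makespan≤ S 0≤X h = maxℚ≤ 0≤X (All.map⁺ (All.tabulate⁺ h))

  -- Two jobs longer than X / 2 do not fit on one machine within X.
  big≤1 : ∀ {X} S j → 0ℚ ≤ X → All (0ℚ ≤_) (jobs S) → load S j ≤ X → wload (above (½ * X)) S j ≤ 1ℚ
  big≤1 {X} S j 0≤X 0≤S load≤X with classify S 0≤S
    where
    big = wload (above (½ * X))

    -- Each case keeps a lower bound on the load, so that one more long job moves the list to the
    -- next case: no long job, one long job and load above X / 2, load above X.
    classify : ∀ S → All (0ℚ ≤_) (jobs S) →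
               big S j ≤ 0ℚ × 0ℚ ≤ load S j ⊎ big S j ≤ 1ℚ × ½ * X < load S j ⊎ X < load S j
    classify [] [] = inj₁ (≤-refl , ≤-refl)
    classify ((p , i) ∷ S) (0≤p ∷ 0≤S) with i Fin.≟ j
    ... | no _ = classify S 0≤S
    ... | yes _ with classify S 0≤S | ½ * X <? p
    ... | inj₂ (inj₂ X<) | _ = inj₂ (inj₂ (<-≤-trans X< (x≤y+x 0≤p)))
    ... | inj₁ (b , l) | yes h = inj₂ (inj₁
      (+-mono-≤ (≤-reflexive (above-yes h)) b , <-≤-trans h (x≤x+y l)))
    ... | inj₁ (b , l) | no h = inj₁
      (≤-trans (≤-reflexive (≡.trans (cong (_+ big S j) (above-no (≮⇒≥ h))) (+-identityˡ _))) b , 0≤p ⊕ l)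
    ... | inj₂ (inj₁ (b , l)) | yes h = inj₂ (inj₂ (subst (_< p + load S j) (½+½ X) (+-mono-< h l)))
    ... | inj₂ (inj₁ (b , l)) | no h = inj₂ (inj₁
      (≤-trans (≤-reflexive (≡.trans (cong (_+ big S j) (above-no (≮⇒≥ h))) (+-identityˡ _))) b
      , <-≤-trans l (x≤y+x 0≤p)))
  ... | inj₁ (b , _)        = ≤-trans b 0≤1
  ... | inj₂ (inj₁ (b , _)) = b
  ... | inj₂ (inj₂ X<)      = ⊥-elim (<-irrefl refl (<-≤-trans X< load≤X))

  -- Summing the loads bounds the average, a single job is bounded by the load of its machine, and
  -- at most one long job per machine gives at most m in total.
  loads≤⇒Fits : ∀ {X} S → 0ℚ ≤ X → All (0ℚ ≤_) (jobs S) → (∀ j → load S j ≤ X) → Fits m X (jobs S)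
  loads≤⇒Fits {X} S 0≤X 0≤S load≤X = fits
    (≤-trans (≤-reflexive (sym (sum-load S))) (sum-≤ (load S) load≤X))
    (jobs≤ S 0≤S load≤X)
    (subst₂ _≤_ (sum-wload (above (½ * X)) S) (*-identityʳ (ι m))
      (sum-≤ (wload (above (½ * X)) S) (λ j → big≤1 S j 0≤X 0≤S (load≤X j))))
    where
    jobs≤ : ∀ S → All (0ℚ ≤_) (jobs S) → (∀ j → load S j ≤ X) → All (_≤ X) (jobs S)
    jobs≤ [] [] _ = []
    jobs≤ ((p , i) ∷ S) (0≤p ∷ 0≤S) load≤X =
      ≤-trans (subst (p ≤_) (sym (load≡wload ((p , i) ∷ S) i)) (≤wload id (0≤p ∷ 0≤S) (here refl))) (load≤X i)
      ∷ jobs≤ S 0≤S (λ j → ≤-trans (load-≤-∷ S i j 0≤p) (load≤X j))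

  -- `zipS` truncates to the shorter list, so equal lengths are what keeps every job.
  jobs-zipS : ∀ σ a → length a ≡ len σ → jobs (zipS σ a) ≡ σ
  jobs-zipS []      a       _  = refl
  jobs-zipS (p ∷ σ) (j ∷ a) eq = cong (p ∷_) (jobs-zipS σ a (ℕ.suc-injective eq))

  assignments-length : ∀ n → All (λ a → length a ≡ n) (assignments n)
  assignments-length zero    = refl ∷ []
  assignments-length (suc n) = All.concat⁺ (All.map⁺ (All.map
    (λ eq → All.map⁺ (All.tabulate⁺ (λ _ → cong suc eq))) (assignments-length n)))

  -- `minℚ` of the empty list is 0, so a lower bound on `OPT` must rest on some assignment; all jobs
  -- go to the first machine.
  assignments-inhabited : ∀ n → ∃ (_∈ assignments n)
  assignments-inhabited zero    = [] , here refl
  assignments-inhabited (suc n) with assignments-inhabited n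
  ... | a , a∈ = j ∷ a , ∈-concatMap⁺ _ (Any.map
                   (λ { refl → ∈-map⁺ (_∷ a) (∈-allFin j) }) a∈)
    where
    j = Fin.fromℕ< (ℕ.>-nonZero⁻¹ m)

  Lof≤OPT : ∀ σ → All (0ℚ ≤_) σ → Lof σ ≤ OPT σ
  Lof≤OPT σ 0≤σ = ≤minℚ (∈-map⁺ _ (proj₂ (assignments-inhabited (len σ))))
    (All.map⁺ (All.map bound (assignments-length (len σ))))
    where
    bound : ∀ {a} → length a ≡ len σ → Lof σ ≤ makespan (zipS σ a)
    bound {a} eq = Lof-least σ 0≤X (subst (Fits m (makespan T)) jobs≡
      (loads≤⇒Fits T 0≤X (subst (All (0ℚ ≤_)) (sym jobs≡) 0≤σ) (load≤makespan T)))
      where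
      T = zipS σ a
      jobs≡ = jobs-zipS σ a eq
      0≤X : 0ℚ ≤ makespan T
      0≤X = ≤-trans (subst (0ℚ ≤_) (sym (load≡wload T j₀)) (0≤wload id j₀ (subst (All (0ℚ ≤_)) (sym jobs≡) 0≤σ)))
                    (load≤makespan T j₀)
        where j₀ = Fin.fromℕ< (ℕ.>-nonZero⁻¹ m)

sumℚ-≤-++ : ∀ ps {qs} → All (0ℚ ≤_) qs → sumℚ ps ≤ sumℚ (ps ++ qs)
sumℚ-≤-++ []       []         = ≤-refl
sumℚ-≤-++ []       (0≤q ∷ 0≤) = ≤-trans (sumℚ-≤-++ [] 0≤) (x≤y+x 0≤q)
sumℚ-≤-++ (p ∷ ps) 0≤         = +-monoʳ-≤ p (sumℚ-≤-++ ps 0≤)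

-- Finiteness of the index set replaces excluded middle.
∀-⊎ : ∀ {n} {P : Fin n → Set} {Q : Set} → (∀ i → P i ⊎ Q) → (∀ i → P i) ⊎ Q
∀-⊎ {zero}  h = inj₁ λ ()
∀-⊎ {suc n} h with h Fin.zero | ∀-⊎ (h ∘ Fin.suc)
... | inj₂ q | _      = inj₂ q
... | inj₁ _ | inj₂ q = inj₂ q
... | inj₁ p | inj₁ f = inj₁ λ { Fin.zero → p ; (Fin.suc i) → f i }

-- Arrival phase: machines of B without their last job

module Analysis (m : ℕ) {{nz : NonZero m}} {c : ℚ} (5/3≤c : + 5 / 3 ≤ c) (c≤2 : c ≤ + 2 / 1) where
  open Alg m c
  open LowerBound m c
  open Schedules m c
  open Arithmetic 5/3≤c c≤2

  M K : ℚ
  M = ι m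
  K = ι ⌊ m /2⌋

  0≤K : 0ℚ ≤ K
  0≤K = 0≤ι ⌊ m /2⌋

  open Machines {M} {K} 0≤K (0<ι-ι½ m) (0≤ι-2ι½ m) (ι-2ι½≤1 m)

  A∩B=∅ : ∀ {j} → InA j → InB j → ⊥
  A∩B=∅ = ℕ.<⇒≱

  A∪B : ∀ j → InA j ⊎ InB j
  A∪B j = ℕ.<-≤-connex (toℕ j) ⌊ m /2⌋

  loads-≤-total : ∀ S {a b} → (∀ j → InA j → a ≤ load S j) → (∀ j → InB j → b ≤ load S j) →
                  K * a + (M - K) * b ≤ sumℚ (jobs S)
  loads-≤-total S {a} {b} a≤ b≤ = subst (K * a + (M - K) * b ≤_) (sum-load S)
    (split-≤-sum ⌊ m /2⌋ (load S) (ℕ.⌊n/2⌋≤n m) a≤ b≤)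

  -- What is known about the load y of a machine of B without its largest job: either it is low,
  -- or the machine last received a small job, at a time with lower bound x.
  data Guard (L : ℚ) (S : Sched) (y : ℚ) : Set where
    low  : y ≤ (c - 1ℚ) * L → Guard L S y
    full : ∀ x → x ≤ L → y ≤ (3ℚ - c) * x → (∀ i → InA i → (c - 1ℚ) * x < loadSmall x S i) → Guard L S y

  Guard-≤ : ∀ {L S y z} → z ≤ y → Guard L S y → Guard L S z
  Guard-≤ z≤y (low y≤)          = low (≤-trans z≤y y≤)
  Guard-≤ z≤y (full x x≤L y≤ A) = full x x≤L (≤-trans z≤y y≤) A

  -- The value x in `full` stays fixed, so the meaning of small does not shift as jobs arrive and
  -- `loadSmall x` on A can only grow.
  Guard-mono : ∀ {L L′ S T y} → L ≤ L′ → (∀ x i → InA i → loadSmall x S i ≤ loadSmall x T i) →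
               Guard L S y → Guard L′ T y
  Guard-mono L≤L′ _   (low y≤)          = low (≤-trans y≤ ([c-1]-mono L≤L′))
  Guard-mono L≤L′ S≤T (full x x≤L y≤ A) =
    full x (≤-trans x≤L L≤L′) y≤ λ i iA → <-≤-trans (A i iA) (S≤T x i iA)

  -- The witness p is the last job placed on the machine; removing any job at least as large leaves
  -- load at most y. The first alternative accounts for a machine that has received nothing.
  Pending : ℚ → Sched → Fin m → Set
  Pending L S j = ∃ λ y → Guard L S y × (load S j ≤ y ⊎ ∃ λ p → (p , j) ∈ S × load S j ≤ p + y)

  Ready : ℚ → Sched → Fin m → Set
  Ready L S j = Guard L S (load S j)

  Lof-nonneg : ∀ ps → All (0ℚ ≤_) ps → 0ℚ ≤ Lof ps
  Lof-nonneg ps 0≤ps = Fits⇒0≤ 0≤ps (Lof-Fits ps)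

  -- A job reaches B only when every machine of A is above its limit. Averaging then bounds the
  -- least load on B, which is the load of j.
  step-Guard : ∀ {hist p j} → ArrivalStep hist p j → 0ℚ < p → All (0ℚ <_) (jobs hist) → InB j →
               Guard (Lof (p ∷ jobs hist)) ((p , j) ∷ hist) (load hist j)
  step-Guard (smallA _ jA _ _) _ _ jB = ⊥-elim (A∩B=∅ jA jB)
  step-Guard (largeA _ _ jA _) _ _ jB = ⊥-elim (A∩B=∅ jA jB)
  step-Guard {hist} {p} {j} (smallB _ none _ least) 0<p 0<hist _ = full L ≤-refl
    (least-load-small (Lof-nonneg (p ∷ jobs hist) (0≤p ∷ 0≤hist)) 0≤p
      (≤-trans (+-monoʳ-≤ p (loads-≤-total hist
          (λ i iA → <⇒≤ (<-≤-trans (above-A i iA) (loadSmall≤load L i 0≤hist))) least))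
        (average (Lof-Fits (p ∷ jobs hist)))))
    λ i iA → <-≤-trans (above-A i iA) (loadSmall-≤-∷ L hist j i 0≤p)
    where
    L = Lof (p ∷ jobs hist)
    0≤p = <⇒≤ 0<p
    0≤hist = All.map <⇒≤ 0<hist
    above-A : ∀ i → InA i → (c - 1ℚ) * L < loadSmall L hist i
    above-A i iA = ≰⇒> λ h → none (i , iA , h)
  step-Guard {hist} {p} {j} (largeB large none _ least) 0<p 0<hist _ = low
    (least-load-large
      (Lof-nonneg (p ∷ jobs hist) (<⇒≤ 0<p ∷ All.map <⇒≤ 0<hist)) (<⇒≤ (≰⇒> large))
      (≤-trans (+-monoʳ-≤ p (loads-≤-total hist
          (λ i iA → <⇒≤ (≰⇒> λ h → none (i , iA , h))) least))
        (average (Lof-Fits (p ∷ jobs hist)))))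

  Lof-∷ : ∀ {p ps} → 0ℚ ≤ p → All (0ℚ ≤_) ps → Lof ps ≤ Lof (p ∷ ps)
  Lof-∷ {p} {ps} 0≤p 0≤ps =
    Lof-least ps (Lof-nonneg (p ∷ ps) (0≤p ∷ 0≤ps)) (Fits-tail 0≤p (Lof-Fits (p ∷ ps)))

  Pending-∷ : ∀ {hist p i j} → i ≢ j → 0ℚ < p → All (0ℚ <_) (jobs hist) →
              Pending (Lof (jobs hist)) hist j → Pending (Lof (p ∷ jobs hist)) ((p , i) ∷ hist) j
  Pending-∷ {hist} {p} {i} {j} i≢j 0<p 0<hist (y , g , bound) = y , g′ , bound′ bound
    where
    g′ : Guard (Lof (p ∷ jobs hist)) ((p , i) ∷ hist) y
    g′ = Guard-mono (Lof-∷ (<⇒≤ 0<p) (All.map <⇒≤ 0<hist)) (λ x k _ → loadSmall-≤-∷ x hist i k (<⇒≤ 0<p)) g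

    bound′ : (load hist j ≤ y ⊎ ∃ λ q → (q , j) ∈ hist × load hist j ≤ q + y) →
      load ((p , i) ∷ hist) j ≤ y ⊎ ∃ λ q → (q , j) ∈ (p , i) ∷ hist × load ((p , i) ∷ hist) j ≤ q + y
    bound′ (inj₁ l≤y)           = inj₁ (≤-trans (≤-reflexive (load-there p hist i≢j)) l≤y)
    bound′ (inj₂ (q , q∈ , l≤)) = inj₂ (q , there q∈ , ≤-trans (≤-reflexive (load-there p hist i≢j)) l≤)

  empty-Pending : ∀ j → Pending (Lof []) [] j
  empty-Pending j = 0ℚ , low (0≤c-1 ⊗ Lof-nonneg [] []) , inj₁ ≤-refl

  arrival-Pending : ∀ {ps S} → Arrival ps S → All (0ℚ <_) (jobs S) →
                    ∀ j → InB j → Pending (Lof (jobs S)) S j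
  arrival-Pending [] _ j _ = empty-Pending j
  arrival-Pending (step {hist = hist} {p} {i} arr st) (0<p ∷ 0<hist) j jB = case i Fin.≟ j of λ where
    (yes refl) → load hist j , step-Guard st 0<p 0<hist jB ,
      inj₂ (p , here refl , ≤-reflexive (load-here p hist j))
    (no i≢j) → Pending-∷ i≢j 0<p 0<hist (arrival-Pending arr 0<hist j jB)

  arrival-jobs : ∀ {ps S} → Arrival ps S → jobs S ≡ ps
  arrival-jobs []           = refl
  arrival-jobs (step arr _) = cong (_ ∷_) (arrival-jobs arr)

  -- Removal of largest jobs

  module Removal {j q S T} (r : RemLargest j S T q) where

    removed-↭ : S ↭ (q , j) ∷ T
    removed-↭ = go r
      where
      go : RemLargest j S T q → S ↭ (q , j) ∷ T
      go (rem xs ys _ _) = shift _ xs ys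

    removed-max : ∀ {p} → (p , j) ∈ S → p ≤ q
    removed-max = go r
      where
      go : ∀ {p} → RemLargest j S T q → (p , j) ∈ S → p ≤ q
      go (rem _ _ _ max) p∈ = All.lookup max p∈ refl

    removed-∈ : (q , j) ∈ S
    removed-∈ = ∈-resp-↭ (↭-sym removed-↭) (here refl)

    T⊆S : ∀ {x} → x ∈ T → x ∈ S
    T⊆S = ∈-resp-↭ (↭-sym removed-↭) ∘ there

    kept : ∀ {p i} → i ≢ j → (p , i) ∈ S → (p , i) ∈ T
    kept i≢j p∈ with ∈-resp-↭ removed-↭ p∈
    ... | here refl = ⊥-elim (i≢j refl)
    ... | there p∈T = p∈T

    load-removed : load S j ≡ q + load T j
    load-removed = ≡.trans (load-↭ removed-↭ j) (load-here q T j)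

    load-kept : ∀ {i} → i ≢ j → load S i ≡ load T i
    load-kept {i} i≢j = ≡.trans (load-↭ removed-↭ i) (load-there q T (i≢j ∘ sym))

    loadSmall-kept : ∀ x {i} → i ≢ j → loadSmall x S i ≡ loadSmall x T i
    loadSmall-kept x {i} i≢j = ≡.trans (loadSmall-↭ x removed-↭ i) (loadSmall-there x q T (i≢j ∘ sym))

    loadSmall-large-removed : ∀ x → threshold x < q → loadSmall x S j ≡ loadSmall x T j
    loadSmall-large-removed x large = ≡.trans (loadSmall-↭ x removed-↭ j) (loadSmall-large x T j large)

    jobs-moved : ∀ R → jobs S ++ R ↭ jobs T ++ q ∷ R
    jobs-moved R = trans (++⁺ʳ R (map⁺ proj₁ removed-↭)) (↭-sym (shift q (jobs T) R))

    pos-removed : All (0ℚ <_) (jobs S) → 0ℚ < q × All (0ℚ <_) (jobs T)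
    pos-removed pos with All-resp-↭ (map⁺ proj₁ removed-↭) pos
    ... | 0<q ∷ 0<T = 0<q , 0<T

  open Removal

  phase1-jobs : ∀ {js S R S′ R′} → Phase1 js S R S′ R′ → jobs S ++ R ↭ jobs S′ ++ R′
  phase1-jobs done              = refl
  phase1-jobs (remJ {R = R} r ph) = trans (jobs-moved r R) (phase1-jobs ph)
  phase1-jobs (skip _ ph)       = phase1-jobs ph

  phase2-jobs : ∀ {L S R S′ R′} → Phase2 L S R S′ R′ → jobs S ++ R ↭ jobs S′ ++ R′
  phase2-jobs (done _)                = refl
  phase2-jobs (remJ {R = R} _ _ r ph) = trans (jobs-moved r R) (phase2-jobs ph)

  -- Induction on the machines still to be treated: a machine of B is already `Ready`, or it is
  -- `Pending` and on the list `js`. An empty list leaves only `Ready`.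
  phase1-Ready : ∀ {L js S R S′ R′} → Phase1 js S R S′ R′ → 0ℚ ≤ L → All InB js → All (0ℚ <_) (jobs S) →
    (∀ j → InB j → Ready L S j ⊎ Pending L S j × j ∈ js) → ∀ j → InB j → Ready L S′ j
  phase1-Ready done 0≤L _ _ h j jB with h j jB
  ... | inj₁ ready     = ready
  ... | inj₂ (_ , ())
  phase1-Ready {L} (skip {j} {js} {S} absent ph) 0≤L (_ ∷ jsB) pos h = phase1-Ready ph 0≤L jsB pos next
    where
    next : ∀ i → InB i → Ready L S i ⊎ Pending L S i × i ∈ js
    next i iB with h i iB
    ... | inj₁ ready                   = inj₁ ready
    ... | inj₂ (pending , there i∈js)  = inj₂ (pending , i∈js)
    ... | inj₂ (_ , here refl)         =
      inj₁ (low (≤-trans (≤-reflexive (load-absent absent)) (0≤c-1 ⊗ 0≤L)))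
  phase1-Ready {L} (remJ {j} {js} {S} {T} {q} r ph) 0≤L (jB ∷ jsB) pos h =
    phase1-Ready ph 0≤L jsB (proj₂ (pos-removed r pos)) next
    where
    keep : ∀ {y} → Guard L S y → Guard L T y
    keep = Guard-mono ≤-refl λ x i iA →
      ≤-reflexive (loadSmall-kept r x λ { refl → A∩B=∅ iA jB })

    -- The removed job q may differ from the witness p, but it is at least as large.
    drop-q : ∀ {p y} → p ≤ q → load S j ≤ p + y → load T j ≤ y
    drop-q {p} {y} p≤q l≤ = +-cancelˡ-≤ q (≤-trans (≤-reflexive (sym (load-removed r)))
      (≤-trans l≤ (+-monoˡ-≤ y p≤q)))

    load-decreases : load T j ≤ load S j
    load-decreases = ≤-trans (x≤y+x (<⇒≤ (proj₁ (pos-removed r pos)))) (≤-reflexive (sym (load-removed r)))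

    here-ready : Ready L S j ⊎ Pending L S j × j ∈ j ∷ js → Ready L T j
    here-ready (inj₁ ready)                                   = Guard-≤ load-decreases (keep ready)
    here-ready (inj₂ ((y , g , inj₁ l≤y) , _))                = Guard-≤ (≤-trans load-decreases l≤y) (keep g)
    here-ready (inj₂ ((y , g , inj₂ (p , p∈ , l≤)) , _))      = Guard-≤ (drop-q (removed-max r p∈) l≤) (keep g)

    there-next : ∀ {i} → i ≢ j → Ready L S i ⊎ Pending L S i × i ∈ j ∷ js → Ready L T i ⊎ Pending L T i × i ∈ js
    there-next i≢j (inj₁ ready) = inj₁ (Guard-≤ (≤-reflexive (sym (load-kept r i≢j))) (keep ready))
    there-next i≢j (inj₂ (_ , here i≡j)) = ⊥-elim (i≢j i≡j)
    there-next i≢j (inj₂ ((y , g , inj₁ l≤y) , there i∈js)) =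
      inj₂ ((y , keep g , inj₁ (≤-trans (≤-reflexive (sym (load-kept r i≢j))) l≤y)) , i∈js)
    there-next i≢j (inj₂ ((y , g , inj₂ (p , p∈ , l≤)) , there i∈js)) =
      inj₂ ((y , keep g , inj₂ (p , kept r i≢j p∈ , ≤-trans (≤-reflexive (sym (load-kept r i≢j))) l≤)) , i∈js)

    next : ∀ i → InB i → Ready L T i ⊎ Pending L T i × i ∈ js
    next i iB = case i Fin.≟ j of λ where
      (yes refl) → inj₁ (here-ready (h j jB))
      (no i≢j)   → there-next i≢j (h i iB)

  Ready⇒≤cL : ∀ {L S j} → 0ℚ ≤ L → Ready L S j → load S j ≤ c * L
  Ready⇒≤cL 0≤L (low l≤)          = ≤-trans l≤ ([c-1]L≤cL 0≤L)
  Ready⇒≤cL 0≤L (full x x≤L l≤ _) = ≤-trans l≤ ([3-c]L′≤cL 0≤L x≤L)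

  -- The level is chosen so that p + (2 - c) L on A and c L - p on B add up to 2 L.
  AFilled : ℚ → (Fin m → ℚ) → Set
  AFilled L f = ∀ i → InA i → (+ 2 / 1 - c) * L ≤ f i

  phase2-A : ∀ {L S R S′ R′} → Phase2 L S R S′ R′ → ∀ i → InA i → load S′ i ≤ (c - 1ℚ) * L
  phase2-A (done A≤)       = A≤
  phase2-A (remJ _ _ _ ph) = phase2-A ph

  phase2-B : ∀ {L S R S′ R′} → Phase2 L S R S′ R′ → ∀ {j} → InB j → load S′ j ≡ load S j
  phase2-B (done _)         jB = refl
  phase2-B (remJ iA _ r ph) jB = ≡.trans (phase2-B ph jB) (sym (load-kept r λ { refl → A∩B=∅ iA jB }))

  -- As long as only jobs large for L leave a machine, `loadSmall x` is unchanged, since these jobs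
  -- are also large for x ≤ L. The first small job to leave is the largest one there, so only small
  -- jobs remain; each such removal starts above (c - 1) L and ends at (2 - c) L or more.
  phase2-AFilled : ∀ {L S R S′ R′ x} → Phase2 L S R S′ R′ → All (0ℚ <_) (jobs S) →
    x ≤ L → (+ 2 / 1 - c) * L ≤ (c - 1ℚ) * x →
    (∀ i → InA i → (c - 1ℚ) * x < loadSmall x S i ⊎
      (+ 2 / 1 - c) * L ≤ load S i × (∀ {p} → (p , i) ∈ S → p ≤ threshold L)) →
    AFilled L (load S′)
  phase2-AFilled {x = x} (done _) pos _ enough h i iA with h i iA
  ... | inj₁ x<       = ≤-trans enough (<⇒≤ (<-≤-trans x< (loadSmall≤load x i (All.map <⇒≤ pos))))
  ... | inj₂ (fill , _) = fill
  phase2-AFilled {L} {S} {x = x} (remJ {j} {S' = T} {p = q} jA over r ph) pos x≤L enough h =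
    phase2-AFilled ph (proj₂ (pos-removed r pos)) x≤L enough next
    where
    Fill : Sched → Fin m → Set
    Fill S i = (c - 1ℚ) * x < loadSmall x S i ⊎
      (+ 2 / 1 - c) * L ≤ load S i × (∀ {p} → (p , i) ∈ S → p ≤ threshold L)

    small-removed : q ≤ threshold L → Fill T j
    small-removed q≤ = inj₂
      ( L≤[2c-3]+[2-c] (subst ((c - 1ℚ) * L <_) (load-removed r) over) q≤
      , λ p∈T → ≤-trans (removed-max r (T⊆S r p∈T)) q≤ )

    large-removed : threshold L < q → Fill S j → Fill T j
    large-removed q> (inj₁ x<) = inj₁ (subst ((c - 1ℚ) * x <_)
      (loadSmall-large-removed r x (≤-<-trans ([2c-3]-mono x≤L) q>)) x<)
    large-removed q> (inj₂ (_ , p≤)) = ⊥-elim (<-irrefl refl (<-≤-trans q> (p≤ (removed-∈ r))))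

    other : ∀ {i} → i ≢ j → Fill S i → Fill T i
    other i≢j (inj₁ x<)        = inj₁ (subst ((c - 1ℚ) * x <_) (loadSmall-kept r x i≢j) x<)
    other i≢j (inj₂ (fill , p≤)) = inj₂ (subst ((+ 2 / 1 - c) * L ≤_) (load-kept r i≢j) fill , λ p∈T → p≤ (T⊆S r p∈T))

    next : ∀ i → InA i → Fill T i
    next i iA = case i Fin.≟ j of λ where
      (no i≢j)   → other i≢j (h i iA)
      (yes refl) → case q ≤? threshold L of λ where
        (yes q≤) → small-removed q≤
        (no q≰)  → large-removed (≰⇒> q≰) (h j jA)

  phase2-Ready : ∀ {L S R S′ R′ j} → Phase2 L S R S′ R′ → 0ℚ ≤ L → All (0ℚ <_) (jobs S) →
    InB j → Ready L S j → load S′ j ≤ (c - 1ℚ) * L ⊎ AFilled L (load S′)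
  phase2-Ready ph 0≤L pos jB (low l≤) = inj₁ (≤-trans (≤-reflexive (phase2-B ph jB)) l≤)
  phase2-Ready {L} ph 0≤L pos jB (full x x≤L l≤ above-A) =
    -- If (3 - c) x is below (c - 1) L, the machine itself is low. Otherwise x is close enough to L
    -- for the small loads on A to reach (2 - c) L.
    case (c - 1ℚ) * L ≤? (3ℚ - c) * x of λ where
      (yes h) → inj₂ (phase2-AFilled ph pos x≤L ([2-c]L≤[c-1]x 0≤L h) (λ i iA → inj₁ (above-A i iA)))
      (no h)  → inj₁ (≤-trans (≤-reflexive (phase2-B ph jB)) (≤-trans l≤ (<⇒≤ (≰⇒> h))))

  -- Reassignment phase

  -- base is the load of the machines at the start of the reassignment.
  module Reassignment (L : ℚ) (base : Fin m → ℚ) where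

    -- By the sorted order, the reassigned job q dominates all of R still waiting; the last clause
    -- says that q came on top of the base load.
    Received : Sched → List ℚ → Fin m → Set
    Received S R j = ∃ λ q → (q , j) ∈ S × All (_≤ q) R × q + base j ≤ load S j

    -- `status` lists the reasons a machine may carry more than (c - 1) L: a job assigned in this
    -- phase, or, on B only, a high load left by the removals, in which case all of A is filled.
    record Invariant (S : Sched) (R : List ℚ) : Set where
      constructor invariant
      field
        fit    : Fits m L (jobs S ++ R)
        jobs>0 : All (0ℚ <_) (jobs S ++ R)
        capped : ∀ j → load S j ≤ c * L
        base≤  : ∀ j → base j ≤ load S j
        status : ∀ j → load S j ≤ (c - 1ℚ) * L ⊎ Received S R j ⊎ InB j × AFilled L base

    open Invariant

    assign : ∀ {S p ps j} → Linked _≥_ (p ∷ ps) → load S j + p ≤ c * L →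
             Invariant S (p ∷ ps) → Invariant ((p , j) ∷ S) ps
    assign {S} {p} {ps} {j} sorted room inv = invariant
      (Fits-↭ (shift p (jobs S) ps) (fit inv))
      pos′
      (λ i → case j Fin.≟ i of λ where
        (yes refl) → ≤-trans (≤-reflexive (≡.trans (load-here p S j) (+-comm p (load S j)))) room
        (no j≢i)   → ≤-trans (≤-reflexive (load-there p S j≢i)) (capped inv i))
      (λ i → ≤-trans (base≤ inv i) (load-≤-∷ S j i (<⇒≤ (All.head pos′))))
      (λ i → case j Fin.≟ i of λ where
        (yes refl) → inj₂ (inj₁ (p , here refl , All.tail (Linked⇒All (flip ≤-trans) ≤-refl sorted) ,
          ≤-trans (+-monoʳ-≤ p (base≤ inv j)) (≤-reflexive (sym (load-here p S j)))))
        (no j≢i)   → other j≢i (status inv i))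
      where
      pos′ = All-resp-↭ (shift p (jobs S) ps) (jobs>0 inv)

      other : ∀ {i} → j ≢ i →
        load S i ≤ (c - 1ℚ) * L ⊎ Received S (p ∷ ps) i ⊎ InB i × AFilled L base →
        load ((p , j) ∷ S) i ≤ (c - 1ℚ) * L ⊎ Received ((p , j) ∷ S) ps i ⊎ InB i × AFilled L base
      other j≢i (inj₁ l≤) = inj₁ (≤-trans (≤-reflexive (load-there p S j≢i)) l≤)
      other j≢i (inj₂ (inj₁ (q , q∈ , ≤q , q+≤))) = inj₂ (inj₁
        (q , there q∈ , All.tail ≤q , ≤-trans q+≤ (≤-reflexive (sym (load-there p S j≢i)))))
      other j≢i (inj₂ (inj₂ filled)) = inj₂ (inj₂ filled)

    -- `status` gives each machine either a received job or `AFilled`. The latter does not depend on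
    -- the machine, so `∀-⊎` separates counting long jobs from bounding the total load.
    not-all-overloaded : ∀ {S p ps} → 0ℚ ≤ L → Invariant S (p ∷ ps) → (∀ j → c * L < load S j + p) → ⊥
    not-all-overloaded {S} {p} {ps} 0≤L inv over = case ∀-⊎ received-or-filled of λ where
        (inj₁ received) → <-irrefl refl (<-≤-trans (ι<1+ι m) (too-many-big received))
        (inj₂ filled)   → rejected⇒overfull 0<p p≤L
          (≤-trans (+-monoʳ-≤ p (loads-≤-total S (filled-load filled) (λ j _ → <⇒≤ (room j)))) p+S≤ML)
      where
      fit′ = Fits-↭ (shift p (jobs S) ps) (fit inv)
      pos′ = All-resp-↭ (shift p (jobs S) ps) (jobs>0 inv)

      0<p : 0ℚ < p
      0<p = All.head pos′

      p≤L : p ≤ L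
      p≤L = All.head (each fit′)

      0≤ps : All (0ℚ ≤_) ps
      0≤ps = All.map <⇒≤ (All.++⁻ʳ (jobs S) (All.tail pos′))

      p+S≤ML : p + sumℚ (jobs S) ≤ M * L
      p+S≤ML = ≤-trans (+-monoʳ-≤ p (sumℚ-≤-++ (jobs S) 0≤ps)) (average fit′)

      room : ∀ j → c * L - p < load S j
      room j = subst (c * L - p <_) (eq (load S j) p) (+-monoˡ-< (- p) (over j))
        where
        eq : ∀ x y → x + y - y ≡ x
        eq = solve-∀ ℚring

      -- No job exceeds L, so a machine at (c - 1) L or less would have had room for p.
      high : ∀ j → load S j ≤ (c - 1ℚ) * L → ⊥
      high j l≤ = <-irrefl refl (<-≤-trans (over j)
        (≤-trans (+-mono-≤ l≤ p≤L) (≤-reflexive (eq c L))))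
        where
        eq : ∀ c L → (c - 1ℚ) * L + L ≡ c * L
        eq = solve-∀ ℚring

      received-or-filled : ∀ j → Received S (p ∷ ps) j ⊎ AFilled L base
      received-or-filled j with status inv j
      ... | inj₁ l≤                   = ⊥-elim (high j l≤)
      ... | inj₂ (inj₁ received)      = inj₁ received
      ... | inj₂ (inj₂ (_ , filled))  = inj₂ filled

      -- On A the only remaining reason for a high load is a received job q ≥ p on top of the base
      -- load.
      filled-load : AFilled L base → ∀ i → InA i → p + (+ 2 / 1 - c) * L ≤ load S i
      filled-load filled i iA with status inv i
      ... | inj₁ l≤                                  = ⊥-elim (high i l≤)
      ... | inj₂ (inj₁ (q , _ , p≤q ∷ _ , q+≤))      = ≤-trans (+-mono-≤ p≤q (filled i iA)) q+≤
      ... | inj₂ (inj₂ (iB , _))                     = ⊥-elim (A∩B=∅ iA iB)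

      big : ½ * L < p
      big = rejected⇒big 0≤L 0<p
        (≤-trans (+-monoʳ-≤ p (loads-≤-total S (λ j _ → <⇒≤ (room j)) (λ j _ → <⇒≤ (room j)))) p+S≤ML)

      ι<1+ι : ∀ n → ι n < 1ℚ + ι n
      ι<1+ι n = subst (_< 1ℚ + ι n) (+-identityˡ (ι n)) (+-monoˡ-< (ι n) (from-yes (0ℚ <? 1ℚ)))

      count = above (½ * L)

      -- The summand 1 is p itself, not yet assigned; every machine adds one job at least as long.
      too-many-big : (∀ j → Received S (p ∷ ps) j) → 1ℚ + ι m ≤ ι m
      too-many-big received = ≤-trans (+-mono-≤ (≤-reflexive (sym (above-yes big)))
        (≤-trans (subst₂ _≤_ (*-identityʳ (ι m)) (sum-wload count S) (≤-sum (wload count S) one-each))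
          (≤-trans (sumℚ-≤-++ (map count (jobs S)) (All.map⁺ (All.universal (0≤above (½ * L)) ps)))
            (≤-reflexive (cong sumℚ (sym (map-++ count (jobs S) ps)))))))
        (few-big fit′)
        where
        one-each : ∀ j → 1ℚ ≤ wload count S j
        one-each j = case received j of λ where
          (q , q∈ , p≤q ∷ _ , _) → ≤-trans (≤-reflexive (sym (above-yes (<-≤-trans big p≤q))))
            (≤wload count (All.universal (0≤above (½ * L)) (jobs S)) q∈)

    reassign-capped : ∀ {R S S′} → 0ℚ ≤ L → Linked _≥_ R → Invariant S R → Reassign L R S S′ →
                      ∀ j → load S′ j ≤ c * L
    reassign-capped 0≤L _ inv done = capped inv
    reassign-capped 0≤L sorted inv (toB jB room re) =
      reassign-capped 0≤L (Linked.tail sorted) (assign sorted room inv) re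
    reassign-capped 0≤L sorted inv (toA {p} {S = S} {j = j} overB jA least re) =
      reassign-capped 0≤L (Linked.tail sorted) (assign sorted room inv) re
      where
      -- If the least loaded machine of A has no room, then no machine of A has; with `overB` every
      -- machine would be overloaded.
      room : load S j + p ≤ c * L
      room = ≮⇒≥ λ over → not-all-overloaded 0≤L inv λ i → case A∪B i of λ where
        (inj₁ iA) → <-≤-trans over (+-monoˡ-≤ p (least i iA))
        (inj₂ iB) → overB i iB

  -- Complete runs and the competitive ratio

  run-capped : ∀ {σ S} → All (0ℚ <_) σ → Run σ S → ∀ j → load S j ≤ c * Lof σ
  run-capped {σ} 0<σ (run {S₀} {S₁} {R₁} {S₂} {R₂} {Rs} arr ph₁ ph₂ Rs↭R₂ sorted re) =
    reassign-capped 0≤L sorted start re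
    where
    L = Lof σ
    open Reassignment L (load S₂)

    S₀↭σ : jobs S₀ ↭ σ
    S₀↭σ = subst (_↭ σ) (sym (arrival-jobs arr)) (↭-reverse σ)

    σ↭S₁ : σ ↭ jobs S₁ ++ R₁
    σ↭S₁ = trans (↭-sym S₀↭σ) (subst (_↭ jobs S₁ ++ R₁) (++-identityʳ (jobs S₀)) (phase1-jobs ph₁))

    σ↭S₂ : σ ↭ jobs S₂ ++ Rs
    σ↭S₂ = trans σ↭S₁ (trans (phase2-jobs ph₂) (++⁺ˡ (jobs S₂) (↭-sym Rs↭R₂)))

    0≤L : 0ℚ ≤ L
    0≤L = Lof-nonneg σ (All.map <⇒≤ 0<σ)

    pos₀ : All (0ℚ <_) (jobs S₀)
    pos₀ = All-resp-↭ (↭-sym S₀↭σ) 0<σ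

    pos₁ : All (0ℚ <_) (jobs S₁)
    pos₁ = All.++⁻ˡ (jobs S₁) (All-resp-↭ σ↭S₁ 0<σ)

    -- The schedule stores jobs latest first, so `jobs S₀` is a permutation of σ, under which `Fits`
    -- is invariant.
    Lof≤L : Lof (jobs S₀) ≤ L
    Lof≤L = Lof-least (jobs S₀) 0≤L (Fits-↭ (↭-sym S₀↭σ) (Lof-Fits σ))

    pending : ∀ j → InB j → Pending L S₀ j
    pending j jB = case arrival-Pending arr pos₀ j jB of λ where
      (y , g , bound) → y , Guard-mono Lof≤L (λ _ _ _ → ≤-refl) g , bound

    ready : ∀ j → InB j → Ready L S₁ j
    ready = phase1-Ready ph₁ 0≤L (All.all-filter _ (allFin m)) pos₀
      λ j jB → inj₂ (pending j jB , ∈-filter⁺ _ (∈-allFin j) jB)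

    start : Invariant S₂ Rs
    start = invariant
      (Fits-↭ σ↭S₂ (Lof-Fits σ))
      (All-resp-↭ σ↭S₂ 0<σ)
      (λ j → case A∪B j of λ where
        (inj₁ jA) → ≤-trans (phase2-A ph₂ j jA) ([c-1]L≤cL 0≤L)
        (inj₂ jB) → ≤-trans (≤-reflexive (phase2-B ph₂ jB)) (Ready⇒≤cL {j = j} 0≤L (ready j jB)))
      (λ _ → ≤-refl)
      (λ j → case A∪B j of λ where
        (inj₁ jA) → inj₁ (phase2-A ph₂ j jA)
        (inj₂ jB) → map₂ (λ filled → inj₂ (jB , filled)) (phase2-Ready ph₂ 0≤L pos₁ jB (ready j jB)))

theorem3 : (m : ℕ) {{nz : NonZero m}} → 2 Data.Nat.≤ m → (c : ℚ) → (+ 5 / 3) ≤ c → c ≤ (+ 2 / 1) →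
    (σ : List ℚ) → All (λ p → 0ℚ < p) σ → (S : Alg.Sched m c) → Alg.Run m c σ S →
    Alg.makespan m c S ≤ c * Alg.OPT m c σ
theorem3 m _ c 5/3≤c c≤2 σ 0<σ S r = ≤-trans
  (makespan≤ S (0≤c ⊗ Lof-nonneg σ 0≤σ) (run-capped 0<σ r))
  (*-monoˡ-≤-nonNeg c {{nonNegative 0≤c}} (Lof≤OPT σ 0≤σ))
  where
  open Schedules m c
  open Arithmetic 5/3≤c c≤2
  open Analysis m 5/3≤c c≤2
  0≤σ = All.map <⇒≤ 0<σ
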